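{- Let $G$ be an arbitrary connected (finite, simple) graph of order $n\geq 3$. Then, for every $k>s_g(G)$ and every finite Abelian group $\mathcal{G}$ of order $k$, $G$ admits a $\mathcal{G}$-irregular labelling, except for the cases when: (i) $G\cong K_{1,n-1}$ and $\mathcal{G}\cong (\mathbb{Z}_3)^q=\mathbb{Z}_3\times\cdots\times\mathbb{Z}_3$ for some $q$ such that $3^q=n+1$; or (ii) $\mathcal{G}\cong (\mathbb{Z}_2)^q=\mathbb{Z}_2\times\cdots\times\mathbb{Z}_2$ for some $q$ such that $2^q=n+2$.
   Context: For a graph $G$ and a finite Abelian group $\mathcal{G}$ (written additively, with neutral element $0$), an edge labelling $f:E(G)\rightarrow \mathcal{G}$ determines the weighted degree $w(v)=\sum_{e\ni v} f(e)$ of each vertex $v$ (sum over all edges incident to $v$). The labelling $f$ is called $\mathcal{G}$-irregular if all weighted degrees are pairwise distinct. The group irregularity strength $s_g(G)$ is the smallest integer $s$ such that for every Abelian group $\mathcal{G}$ of order $s$ there exists a $\mathcal{G}$-irregular labelling of $G$. $K_{1,m}$ denotes the star with $m$ leaves. -}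

module Defs where

open import Level using (0ℓ)
open import Data.Nat as ℕ using (ℕ; zero; suc; _≤_; _<_; _^_; _∸_)
open import Data.Nat.DivMod using (_mod_)
open import Data.Fin as Fin using (Fin; toℕ)
open import Data.Bool using (Bool; true; false; if_then_else_)
open import Data.Vec using (Vec; zipWith)
open import Data.Product using (Σ; _×_; ∃; ∃-syntax; _,_)
open import Data.Sum using (_⊎_)
open import Relation.Nullary using (¬_)
open import Relation.Binary.PropositionalEquality as ≡ using (_≡_)
open import Function.Bundles using (Inverse)
open import Algebra.Bundles using (AbelianGroup)

record Graph (n : ℕ) : Set where
  field
    Adj   : Fin n → Fin n → Bool
    sym   : ∀ u v → Adj u v ≡ Adj v u
    irrefl : ∀ v → Adj v v ≡ false
open Graph public

data Reach {n : ℕ} (G : Graph n) : Fin n → Fin n → Set where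
  here : ∀ {v} → Reach G v v
  step : ∀ {u v w} → Adj G u v ≡ true → Reach G v w → Reach G u w

Connected : ∀ {n} → Graph n → Set
Connected G = ∀ u v → Reach G u v

_≅G_ : ∀ {n m} → Graph n → Graph m → Set
_≅G_ {n} {m} G H =
  Σ (Inverse (≡.setoid (Fin n)) (≡.setoid (Fin m))) λ φ →
    ∀ u v → Adj G u v ≡ Adj H (Inverse.to φ u) (Inverse.to φ v)

-- the star K_{1,m}: vertex 0 is the centre, vertices 1..m are the leaves
isZero : ∀ {n} → Fin n → Bool
isZero Fin.zero = true
isZero (Fin.suc _) = false

K1 : (m : ℕ) → Graph (suc m)
K1 m = record
  { Adj = adj
  ; sym = sy
  ; irrefl = ir
  }
  where
  xor : Bool → Bool → Bool
  xor true b = if b then false else true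
  xor false b = b
  adj : Fin (suc m) → Fin (suc m) → Bool
  adj u v = xor (isZero u) (isZero v)
  sy : ∀ u v → adj u v ≡ adj v u
  sy Fin.zero Fin.zero = ≡.refl
  sy Fin.zero (Fin.suc v) = ≡.refl
  sy (Fin.suc u) Fin.zero = ≡.refl
  sy (Fin.suc u) (Fin.suc v) = ≡.refl
  ir : ∀ v → adj v v ≡ false
  ir Fin.zero = ≡.refl
  ir (Fin.suc v) = ≡.refl

HasOrder : AbelianGroup 0ℓ 0ℓ → ℕ → Set
HasOrder A k = Inverse (AbelianGroup.setoid A) (≡.setoid (Fin k))

-- (Z_p)^q represented as Vec (Fin p) q with componentwise addition mod p
addMod : (p : ℕ) → .{{_ : ℕ.NonZero p}} → Fin p → Fin p → Fin p
addMod p a b = (toℕ a ℕ.+ toℕ b) mod p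

_≅Zpow_^_ : AbelianGroup 0ℓ 0ℓ → (p : ℕ) → .{{_ : ℕ.NonZero p}} → ℕ → Set
A ≅Zpow p ^ q =
  Σ (Inverse (AbelianGroup.setoid A) (≡.setoid (Vec (Fin p) q))) λ φ →
    ∀ x y → Inverse.to φ (AbelianGroup._∙_ A x y)
              ≡ zipWith (addMod p) (Inverse.to φ x) (Inverse.to φ y)

module _ (A : AbelianGroup 0ℓ 0ℓ) where
  open AbelianGroup A renaming (Carrier to C)

  ΣFin : ∀ {n} → (Fin n → C) → C
  ΣFin {zero} g = ε
  ΣFin {suc n} g = g Fin.zero ∙ ΣFin (λ i → g (Fin.suc i))

  -- an edge labelling: f u v is the label of the edge uv (only values on
  -- edges matter); it is a function of the unordered pair {u,v}
  record Labelling {n : ℕ} (G : Graph n) : Set where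
    field
      lab  : Fin n → Fin n → C
      symm : ∀ u v → lab u v ≈ lab v u

  wdeg : ∀ {n} {G : Graph n} → Labelling G → Fin n → C
  wdeg {G = G} f v = ΣFin (λ u → if Adj G v u then Labelling.lab f v u else ε)

  Irregular : ∀ {n} {G : Graph n} → Labelling G → Set
  Irregular f = ∀ u v → wdeg f u ≈ wdeg f v → u ≡ v

Admits : ∀ {n} → Graph n → AbelianGroup 0ℓ 0ℓ → Set
Admits G A = Σ (Labelling A G) (Irregular A)

GoodOrder : ∀ {n} → Graph n → ℕ → Set₁
GoodOrder G s = (A : AbelianGroup 0ℓ 0ℓ) → HasOrder A s → Admits G A

IsGroupIrregStrength : ∀ {n} → Graph n → ℕ → Set₁
IsGroupIrregStrength G s =
  1 ≤ s × GoodOrder G s × (∀ t → 1 ≤ t → t < s → ¬ GoodOrder G t)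

ExceptionI : ∀ {n} → Graph n → AbelianGroup 0ℓ 0ℓ → Set
ExceptionI {n} G A =
  (G ≅G K1 (n ∸ 1)) × ∃[ q ] (3 ^ q ≡ suc n × (A ≅Zpow 3 ^ q))

ExceptionII : ℕ → AbelianGroup 0ℓ 0ℓ → Set
ExceptionII n A = ∃[ q ] (2 ^ q ≡ suc (suc n) × (A ≅Zpow 2 ^ q))

{-# OPTIONS --safe #-}
module Submission where

-- Send a label alternately as a, - a, a, … along a walk from v to a root r: only the weights of v and r
-- change.  Hence, choosing a walk from every vertex to r, every weight function w with Σ ± w(v) = 0, the
-- signs being the parities of the walks, is realised by some labelling.  It remains to find disjoint
-- subsets of the group with p and m elements (the numbers of vertices of each sign) and equal sums.
-- Pairs {x , - x} may be added to either side, so everything reduces to parities and to the subgroup I of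
-- elements with 2x = 0.  If |I| ≤ 2, the only difficulty is p and m both odd, settled by a set of three
-- elements with the same sum as a single one.  If |I| ≥ 4, I is cut into cosets of a Klein four-group, each
-- with sum 0.  What fails is exactly (ℤ₃)^q with p = 1 or m = 1 and one spare element, and (ℤ₂)^q with two
-- spare elements.  In the first case a graph with two disjoint edges has walks with two vertices of each
-- sign, and a connected graph without them is a star.
-- Conversely the sum of all elements of (ℤ₃)^q or (ℤ₂)^q (q ≥ 2) is 0: in the star the missing element would
-- be the weight of the centre, and in (ℤ₂)^q the two missing elements would coincide.
-- The strength enters only through k > s_g(G) ≥ n.

open import Defs renaming (sym to Adj-sym)
open import Level using (0ℓ)
open import Data.Nat as ℕ using (ℕ; zero; suc; _+_; _*_; _∸_; _≤_; _<_; z≤n; s≤s; NonZero)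
import Data.Nat.Properties as ℕₚ
open import Data.Nat.DivMod using (_/_; _%_; _mod_; m≡m%n+[m/n]*n; m%n<n; %-distribˡ-+; m%n%n≡m%n; m<n⇒m%n≡m; [m+n]%n≡m%n)
open import Data.Nat.Solver using (module +-*-Solver)
open import Data.Bool as Bool using (Bool; true; false; not; _xor_; if_then_else_)
open import Data.Bool.Properties using (¬-not)
open import Data.Empty using (⊥)
open import Data.Product using (Σ; _×_; _,_; ∃-syntax; proj₁; proj₂; uncurry)
open import Data.Sum as Sum using (_⊎_; inj₁; inj₂; [_,_]′)
open import Data.Fin as Fin using (Fin; toℕ; fromℕ<)
import Data.Fin.Properties as Finₚ
import Data.Fin.Permutation as Permutation
open import Data.Vec using (Vec; []; _∷_; zipWith)
open import Data.List using (List; []; _∷_; _++_; length; filter; concatMap; foldr; allFin; take; drop; tabulate)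
open import Data.List.Properties using (length-++; length-take; length-drop; length-tabulate; take++drop≡id; ++-assoc; ++-identityʳ)
import Data.List.Relation.Unary.Any as Any
open import Data.List.Relation.Unary.Any using (here; there)
import Data.List.Relation.Unary.All as All
open import Data.List.Relation.Unary.All using (All; []; _∷_)
import Data.List.Relation.Unary.All.Properties as Allₚ
open import Data.List.Relation.Unary.AllPairs using ([]; _∷_)
open import Data.List.Relation.Unary.Unique.Propositional using (Unique)
import Data.List.Relation.Unary.Unique.Propositional.Properties as Uniqueₚ
open import Data.List.Membership.Propositional using (_∈_; _∉_)
open import Data.List.Membership.Propositional.Properties using (∈-∃++; ∈-++⁻; ∈-++⁺ˡ; ∈-++⁺ʳ; ∈-filter⁺; ∈-filter⁻; ∈-allFin; ∈-tabulate⁺)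
import Data.List.Relation.Binary.Permutation.Propositional as ↭
open import Data.List.Relation.Binary.Permutation.Propositional using (_↭_; ↭-refl; ↭-sym; ↭-trans; ↭-reflexive; prep; swap)
import Data.List.Relation.Binary.Permutation.Propositional.Properties as ↭ₚ
import Data.List.Relation.Binary.Permutation.Setoid.Properties as ↭ₛ
open import Relation.Binary.Definitions using (tri<; tri≈; tri>)
open import Relation.Binary.PropositionalEquality as ≡ using (_≡_; _≢_; refl; sym; trans; cong; cong₂; subst; module ≡-Reasoning)
open import Relation.Nullary using (¬_; Dec; yes; no; does; contradiction)
open import Relation.Nullary.Decidable using (dec-true; dec-false; ¬?; _×-dec_; map′; decidable-stable)
open import Relation.Unary using (Pred; Decidable)
open import Relation.Unary.Properties using (∁?)
open import Algebra.Bundles using (AbelianGroup)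
open import Algebra.Structures using (IsAbelianGroup)
open import Algebra.Morphism.Structures using (IsGroupMonomorphism)
import Algebra.Morphism.GroupMonomorphism as GroupMonomorphism
import Algebra.Properties.AbelianGroup as AbelianGroupₚ
import Algebra.Properties.CommutativeMonoid.Mult as CommutativeMonoidMult
import Algebra.Properties.CommutativeSemigroup as CommutativeSemigroupₚ
open import Function using (_∘_)
open import Function.Bundles using (Inverse; mk↔ₛ′)

-- No distinction between bipartite and other graphs is made: any choice of walks gives a sufficient
-- condition, and the walks are changed only in the one case where the resulting signs are fatal.
-- That case is (ℤ₃)^q with a single vertex of one sign and one spare element `y`: if `x` is the
-- lone weight, the others sum to `x` as well, all elements sum to 0, so 2x + y = 0 and hence y = x.
-- In (ℤ₂)^q signs are void, and a zero-sum set with as many elements as there are vertices is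
-- wanted. The obstacle is the residue of its size modulo 4. Whole cosets give residue 0, and the
-- Klein group gives 1 and 3 by 0 and by its other elements; residue 2 cannot be met inside it,
-- since two different involutions never sum to 0. Taking complements, a set missing just two
-- elements is impossible too; this is the exception. Between these extremes a zero-sum set of six
-- elements, spread over four cosets, fills the gap. If some element is not an involution, one pair
-- {x , - x} already repairs the residue, unless p = m = 1, which three vertices exclude.

-- Lists: permutations, complements, decomposition into blocks

module _ {A : Set} where

  ∈⇒↭∷ : {x : A} {xs : List A} → x ∈ xs → ∃[ ys ] xs ↭ x ∷ ys
  ∈⇒↭∷ {x} x∈ with ys , zs , refl ← ∈-∃++ x∈ = ys ++ zs , ↭ₚ.shift x ys zs

  ∷↭++∷ : (xs : List A) {x : A} {ys zs : List A} → zs ↭ xs ++ ys → x ∷ zs ↭ xs ++ x ∷ ys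
  ∷↭++∷ xs p = ↭-trans (prep _ p) (↭-sym (↭ₚ.shift _ xs _))

  -- For `zeroSum-6`: the first elements of three cosets and all but the first of a fourth are
  -- selected.
  heads-↭ : {x y z e : A} (ws xs ys zs : List A) →
            x ∷ y ∷ z ∷ (zs ++ (ws ++ (xs ++ (ys ++ (e ∷ []))))) ↭ (x ∷ ws) ++ ((y ∷ xs) ++ ((z ∷ ys) ++ (e ∷ zs)))
  heads-↭ {x} {y} {z} {e} ws xs ys zs =
    prep x (∷↭++∷ ws (↭-trans (∷↭++∷ (ws ++ xs) inner) (↭-reflexive (++-assoc ws xs _))))
    where
    inner : zs ++ (ws ++ (xs ++ (ys ++ (e ∷ [])))) ↭ (ws ++ xs) ++ (ys ++ (e ∷ zs))
    inner = ↭-trans (↭ₚ.++-comm zs _) (↭-reflexive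
      (≡.trans (++-assoc ws _ zs) (≡.trans (cong (ws ++_) (≡.trans (++-assoc xs _ zs) (cong (xs ++_) (++-assoc ys (e ∷ []) zs))))
        (≡.sym (++-assoc ws xs _)))))

  Unique-resp-↭ : {xs ys : List A} → xs ↭ ys → Unique xs → Unique ys
  Unique-resp-↭ p = ↭ₛ.Unique-resp-↭ (≡.setoid A) (↭.↭⇒↭ₛ p)

  Unique-++⁻ʳ : (xs : List A) {ys : List A} → Unique (xs ++ ys) → Unique ys
  Unique-++⁻ʳ []       u       = u
  Unique-++⁻ʳ (_ ∷ xs) (_ ∷ u) = Unique-++⁻ʳ xs u

  Unique-++⁻ˡ : (xs : List A) {ys : List A} → Unique (xs ++ ys) → Unique xs
  Unique-++⁻ˡ []       u       = []
  Unique-++⁻ˡ (_ ∷ xs) (a ∷ u) = Allₚ.++⁻ˡ xs a ∷ Unique-++⁻ˡ xs u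

  Unique-++-disjoint : (xs : List A) {ys : List A} {z : A} → Unique (xs ++ ys) → z ∈ xs → z ∉ ys
  Unique-++-disjoint (x ∷ xs) u       (here refl) z∈ = Uniqueₚ.Unique[x∷xs]⇒x∉xs u (∈-++⁺ʳ xs z∈)
  Unique-++-disjoint (_ ∷ xs) (_ ∷ u) (there p)   z∈ = Unique-++-disjoint xs u p z∈

  tail-∈ : {x y : A} {xs : List A} → y ∈ x ∷ xs → y ≢ x → y ∈ xs
  tail-∈ (here eq) y≢x = contradiction eq y≢x
  tail-∈ (there p) _   = p

  ⊆⇒↭++ : (xs : List A) {ys : List A} → Unique xs → (∀ {z} → z ∈ xs → z ∈ ys) →
          ∃[ zs ] ys ↭ xs ++ zs
  ⊆⇒↭++ []       {ys} _       _   = ys , ↭-refl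
  ⊆⇒↭++ (x ∷ xs) {ys} (a ∷ u) sub
    with ys′ , p ← ∈⇒↭∷ (sub (here refl))
    with zs , q ← ⊆⇒↭++ xs u (λ z∈ → tail-∈ (↭ₚ.∈-resp-↭ p (sub (there z∈)))
                                     (λ { refl → Uniqueₚ.Unique[x∷xs]⇒x∉xs (a ∷ u) z∈ }))
    = zs , ↭-trans p (prep x q)

  filter-split : {P : Pred A 0ℓ} (P? : Decidable P) (xs : List A) →
                 xs ↭ filter P? xs ++ filter (∁? P?) xs
  filter-split P? []       = ↭-refl
  filter-split P? (x ∷ xs) with P? x
  ... | yes _ = prep x (filter-split P? xs)
  ... | no  _ = ↭-trans (prep x (filter-split P? xs))
                        (↭-sym (↭ₚ.shift x (filter P? xs) (filter (∁? P?) xs)))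

  Unique-tabulate⁻ : ∀ {n} (f : Fin n → A) → Unique (tabulate f) → ∀ i j → f i ≡ f j → i ≡ j
  Unique-tabulate⁻ f u Fin.zero Fin.zero eq = refl
  Unique-tabulate⁻ f (a ∷ u) Fin.zero (Fin.suc j) eq = contradiction eq (Allₚ.tabulate⁻ a j)
  Unique-tabulate⁻ f (a ∷ u) (Fin.suc i) Fin.zero eq = contradiction (≡.sym eq) (Allₚ.tabulate⁻ a i)
  Unique-tabulate⁻ f (a ∷ u) (Fin.suc i) (Fin.suc j) eq =
    cong Fin.suc (Unique-tabulate⁻ (λ i → f (Fin.suc i)) u i j eq)

  -- `self` and `meet` together say that `y ∈ block x` is an equivalence relation. The instances are
  -- the pairs of an element and its inverse, and the cosets of a Klein four-group.
  module Blocks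
    (block : A → List A)
    (self  : ∀ x → x ∈ block x)
    (meet  : ∀ {x y z} → z ∈ block x → z ∈ block y → y ∈ block x)
    where

    blocks : List A → List A
    blocks = concatMap block

    -- Only blocks of members must be free of repetitions: `pair x` is not when `x` is an
    -- involution.
    record Closed (xs : List A) : Set where
      field
        unique        : Unique xs
        block-unique  : ∀ {x} → x ∈ xs → Unique (block x)
        block-⊆       : ∀ {x z} → x ∈ xs → z ∈ block x → z ∈ xs
    open Closed

    abstract
      split-block : ∀ {x xs} → Closed xs → x ∈ xs → ∃[ ys ] (xs ↭ block x ++ ys) × Closed ys
      split-block {x} {xs} c x∈
        with ys , p ← ⊆⇒↭++ (block x) (block-unique c x∈) (block-⊆ c x∈)
        = ys , p , record
          { unique       = Unique-++⁻ʳ (block x) u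
          ; block-unique = λ y∈ → block-unique c (up y∈)
          ; block-⊆      = sub
          }
        where
        u : Unique (block x ++ ys)
        u = Unique-resp-↭ p (unique c)
        up : ∀ {y} → y ∈ ys → y ∈ xs
        up y∈ = ↭ₚ.∈-resp-↭ (↭-sym p) (∈-++⁺ʳ (block x) y∈)
        sub : ∀ {y z} → y ∈ ys → z ∈ block y → z ∈ ys
        sub y∈ z∈ with ∈-++⁻ (block x) (↭ₚ.∈-resp-↭ p (block-⊆ c (up y∈) z∈))
        ... | inj₂ z∈ys = z∈ys
        -- If the block of `y` met `block x`, then `y` itself would lie in `block x`.
        ... | inj₁ z∈bx = contradiction y∈ (Unique-++-disjoint (block x) u (meet z∈bx z∈))

      private
        shorter : {x : A} {bs xs ys : List A} → xs ↭ bs ++ ys → x ∈ bs → length ys < length xs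
        shorter {bs = b ∷ bs} {ys = ys} p _ rewrite ↭ₚ.↭-length p | length-++ bs {ys} =
          s≤s (ℕₚ.m≤n+m (length ys) (length bs))

        go : ∀ n {xs} → length xs ≤ n → Closed xs → ∃[ ps ] xs ↭ blocks ps
        go n       {[]}     _ _ = [] , ↭-refl
        go (suc n) {x ∷ xs} l c
          with ys , p , cy ← split-block c (here refl)
          with ps , q ← go n (ℕₚ.≤-pred (ℕₚ.≤-trans (shorter p (self x)) l)) cy
          = x ∷ ps , ↭-trans p (↭ₚ.++⁺ˡ (block x) q)

      decompose : ∀ {xs} → Closed xs → ∃[ ps ] xs ↭ blocks ps
      decompose = go _ ℕₚ.≤-refl

-- Arithmetic: halves, residues modulo 4, digits in base p

-- The remainder stays a visible summand, even when it is 0, so that the index has the shape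
-- `x * 2 + c` expected by `balanced-base`.
data Half : ℕ → Set where
  even : ∀ x → Half (x * 2 + 0)
  odd  : ∀ x → Half (x * 2 + 1)

half : ∀ n → Half n
half zero          = even 0
half (suc zero)    = odd 0
half (suc (suc n)) with half n
... | even x = even (suc x)
... | odd  x = odd (suc x)

suc-odd : ∀ x → suc x * 2 + 1 ≡ x * 2 + 3
suc-odd = solve 1 (λ x → (con 1 :+ x) :* con 2 :+ con 1 := x :* con 2 :+ con 3) refl
  where open +-*-Solver

-- Parity absorbs the extra one, since an even number below `r * 2 + 2` is at most `r * 2`. This is
-- what allows a base to waste one element more than the number known to be spare.
halves-≤ : ∀ x y c d r → x * 2 + c + (y * 2 + d) ≤ suc (r * 2 + (c + d)) → x + y ≤ r
halves-≤ x y c d r h = ℕₚ.≤-pred (ℕₚ.*-cancelʳ-< _ (x + y) (suc r) (s≤s h′))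
  where
  eq : x * 2 + c + (y * 2 + d) ≡ (x + y) * 2 + (c + d)
  eq = solve 4 (λ x y c d → x :* con 2 :+ c :+ (y :* con 2 :+ d) := (x :+ y) :* con 2 :+ (c :+ d)) refl x y c d
    where open +-*-Solver
  h′ : (x + y) * 2 ≤ suc (r * 2)
  h′ = ℕₚ.+-cancelʳ-≤ (c + d) _ _ (ℕₚ.≤-trans (ℕₚ.≤-reflexive (sym eq)) h)

data Quarter : ℕ → Set where
  rem0 : ∀ j → Quarter (j * 4 + 0)
  rem1 : ∀ j → Quarter (j * 4 + 1)
  rem2 : ∀ j → Quarter (j * 4 + 2)
  rem3 : ∀ j → Quarter (j * 4 + 3)

quarter : ∀ n → Quarter n
quarter 0 = rem0 0
quarter 1 = rem1 0
quarter 2 = rem2 0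
quarter 3 = rem3 0
quarter (suc (suc (suc (suc n)))) with quarter n
... | rem0 j = rem0 (suc j)
... | rem1 j = rem1 (suc j)
... | rem2 j = rem2 (suc j)
... | rem3 j = rem3 (suc j)

-- Numbering the coordinate vectors makes a search over them decidable and lets them be counted.
encode : ∀ p {q} → Vec (Fin p) q → Fin (p ℕ.^ q)
encode p []       = Fin.zero
encode p (c ∷ cs) = Fin.combine c (encode p cs)

decode : ∀ p {q} → Fin (p ℕ.^ q) → Vec (Fin p) q
decode p {zero}  _ = []
decode p {suc q} i = Fin.quotient {p} (p ℕ.^ q) i ∷ decode p (Fin.remainder {p} (p ℕ.^ q) i)

decode-encode : ∀ p {q} (cs : Vec (Fin p) q) → decode p (encode p cs) ≡ cs
decode-encode p []       = refl
decode-encode p {suc q} (c ∷ cs) = cong₂ _∷_ (cong proj₁ (Finₚ.remQuot-combine c (encode p cs)))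
  (trans (cong (decode p ∘ proj₂) (Finₚ.remQuot-combine c (encode p cs))) (decode-encode p cs))

encode-decode : ∀ p q (i : Fin (p ℕ.^ q)) → encode p (decode p {q} i) ≡ i
encode-decode p zero Fin.zero = refl
encode-decode p (suc q) i = trans (cong (Fin.combine (Fin.quotient {p} (p ℕ.^ q) i)) (encode-decode p q (Fin.remainder {p} (p ℕ.^ q) i)))
                                  (Finₚ.combine-remQuot {p} (p ℕ.^ q) i)

n<p^n : ∀ {p} → 2 ≤ p → ∀ n → n < p ℕ.^ n
n<p^n 2≤p zero    = s≤s z≤n
n<p^n {p} 2≤p (suc n) = begin
  2 + n                 ≤⟨ s≤s (ℕₚ.m≤n+m (suc n) n) ⟩
  suc n + suc n         ≤⟨ ℕₚ.+-mono-≤ (n<p^n 2≤p n) (n<p^n 2≤p n) ⟩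
  p ℕ.^ n + p ℕ.^ n     ≡⟨ cong (p ℕ.^ n +_) (ℕₚ.+-identityʳ _) ⟨
  2 * p ℕ.^ n           ≤⟨ ℕₚ.*-monoˡ-≤ (p ℕ.^ n) 2≤p ⟩
  p * p ℕ.^ n           ∎
  where open ℕₚ.≤-Reasoning

-- Walks, their signs, and counting

-- true (+) for odd length, false (-) for even length: the sign with which a label sent from v arrives at r.
sign : ∀ {n} {G : Graph n} {v r} → Reach G v r → Bool
sign here       = false
sign (step _ W) = not (sign W)

count : ∀ {n} → (Fin n → Bool) → ℕ
count {zero}  σ = 0
count {suc n} σ = (if σ Fin.zero then 1 else 0) + count (σ ∘ Fin.suc)

count-not : ∀ {n} (σ : Fin n → Bool) → count σ + count (not ∘ σ) ≡ n
count-not {zero}  σ = refl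
count-not {suc n} σ with σ Fin.zero
... | true  = cong suc (count-not (σ ∘ Fin.suc))
... | false = trans (ℕₚ.+-suc _ _) (cong suc (count-not (σ ∘ Fin.suc)))

count≥1 : ∀ {n} (σ : Fin n → Bool) {i} → σ i ≡ true → 1 ≤ count σ
count≥1 σ {Fin.zero}  eq rewrite eq = s≤s z≤n
count≥1 σ {Fin.suc i} eq = ℕₚ.≤-trans (count≥1 (σ ∘ Fin.suc) eq) (ℕₚ.m≤n+m _ _)

count≥2 : ∀ {n} (σ : Fin n → Bool) {i j} → i ≢ j → σ i ≡ true → σ j ≡ true → 2 ≤ count σ
count≥2 σ {Fin.zero}  {Fin.zero}  i≢j _  _  = contradiction refl i≢j
count≥2 σ {Fin.zero}  {Fin.suc j} i≢j eq eq′ rewrite eq = s≤s (count≥1 (σ ∘ Fin.suc) eq′)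
count≥2 σ {Fin.suc i} {Fin.zero}  i≢j eq eq′ rewrite eq′ = s≤s (count≥1 (σ ∘ Fin.suc) eq)
count≥2 σ {Fin.suc i} {Fin.suc j} i≢j eq eq′ =
  ℕₚ.≤-trans (count≥2 (σ ∘ Fin.suc) (i≢j ∘ cong Fin.suc) eq eq′) (ℕₚ.m≤n+m _ _)

fresh : ∀ {n} (xs : List (Fin n)) → length xs < n → ∃[ x ] x ∉ xs
fresh {n} xs lt with Finₚ.any? (λ x → ¬? (Any.any? (x Fin.≟_) xs))
... | yes found = found
... | no ¬∃ with zs , p ← ⊆⇒↭++ (allFin n) (Uniqueₚ.allFin⁺ n)
                         (λ {z} _ → decidable-stable (Any.any? (z Fin.≟_) xs) (λ z∉ → ¬∃ (z , z∉))) =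
  contradiction lt (ℕₚ.≤⇒≯ (begin
    n                              ≡⟨ length-tabulate {n = n} (λ i → i) ⟨
    length (allFin n)              ≤⟨ ℕₚ.m≤m+n _ _ ⟩
    length (allFin n) + length zs  ≡⟨ length-++ (allFin n) ⟨
    length (allFin n ++ zs)        ≡⟨ ↭ₚ.↭-length p ⟨
    length xs                      ∎))
  where open ℕₚ.≤-Reasoning

-- Stars and disjoint edges

record IsStar {n : ℕ} (G : Graph n) (c : Fin n) : Set where
  field
    spoke  : ∀ {v} → v ≢ c → Adj G c v ≡ true
    leaves : ∀ {u v} → u ≢ c → v ≢ c → Adj G u v ≡ false

record DisjointEdges {n : ℕ} (G : Graph n) : Set where
  field
    {a b c d} : Fin n
    ab  : Adj G a b ≡ true
    cd  : Adj G c d ≡ true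
    a≢c : a ≢ c
    a≢d : a ≢ d
    b≢c : b ≢ c
    b≢d : b ≢ d

adjacent⇒≢ : ∀ {n} (G : Graph n) {u v} → Adj G u v ≡ true → u ≢ v
adjacent⇒≢ G {u} uv refl with () ← trans (sym uv) (irrefl G u)

disjointEdges? : ∀ {n} (G : Graph n) → Dec (DisjointEdges G)
disjointEdges? G = map′
  (λ { (a , b , c , d , ab , cd , ac , ad , bc , bd) → record { ab = ab ; cd = cd ; a≢c = ac ; a≢d = ad ; b≢c = bc ; b≢d = bd } })
  (λ e → let open DisjointEdges e in a , b , c , d , ab , cd , a≢c , a≢d , b≢c , b≢d)
  (Finₚ.any? λ a → Finₚ.any? λ b → Finₚ.any? λ c → Finₚ.any? λ d →
    (Adj G a b Bool.≟ true) ×-dec (Adj G c d Bool.≟ true) ×-dec ¬? (a Fin.≟ c) ×-dec ¬? (a Fin.≟ d) ×-dec ¬? (b Fin.≟ c) ×-dec ¬? (b Fin.≟ d))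

module _ {n : ℕ} (G : Graph n) (4≤n : 4 ≤ n) (connected : Connected G) where

  adjacent-sym : ∀ {u v} → Adj G u v ≡ true → Adj G v u ≡ true
  adjacent-sym {u} {v} uv = trans (Adj-sym G v u) uv

  neighbour : ∀ v → ∃[ y ] Adj G v y ≡ true
  neighbour v with u , u∉ ← fresh (v ∷ []) (ℕₚ.≤-trans (s≤s (s≤s z≤n)) 4≤n) with connected v u
  ... | here     = contradiction (here refl) u∉
  ... | step e _ = _ , e

  module _ (¬disjoint : ¬ DisjointEdges G) where

    meet : ∀ {a b c d} → Adj G a b ≡ true → Adj G c d ≡ true → a ≢ c → a ≢ d → b ≢ c → b ≡ d
    meet {a} {b} {c} {d} ab cd a≢c a≢d b≢c = decidable-stable (b Fin.≟ d) λ b≢d →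
      ¬disjoint (record { ab = ab ; cd = cd ; a≢c = a≢c ; a≢d = a≢d ; b≢c = b≢c ; b≢d = b≢d })

    -- Every edge must meet `ab`, and at `b` only `ab` itself can do so; hence all edges pass
    -- through `a`. Every other vertex has a neighbour, which then has to be `a`.
    star-at : ∀ {a b} → Adj G a b ≡ true → (∀ {y} → Adj G b y ≡ true → y ≡ a) → IsStar G a
    star-at {a} {b} ab only = record
      { spoke  = λ {v} v≢a → spoke v≢a (v Fin.≟ b)
      ; leaves = λ {u} {v} u≢a v≢a → ¬-not λ uv → leaves u≢a v≢a uv }
      where
      spoke : ∀ {v} → v ≢ a → Dec (v ≡ b) → Adj G a v ≡ true
      spoke v≢a (yes refl) = ab
      spoke {v} v≢a (no v≢b) with y , vy ← neighbour v with y Fin.≟ a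
      ... | yes refl = adjacent-sym vy
      ... | no y≢a with refl ← meet vy ab v≢a v≢b y≢a = contradiction (only (adjacent-sym vy)) v≢a
      leaves : ∀ {u v} → u ≢ a → v ≢ a → Adj G u v ≡ true → ⊥
      leaves {u} {v} u≢a v≢a uv with u Fin.≟ b
      ... | yes refl = v≢a (only uv)
      ... | no u≢b with refl ← meet uv ab u≢a u≢b v≢a = u≢a (only (adjacent-sym uv))

    -- Two edges by and az at the ends of ab must share y = z, and then no fourth vertex can attach to the triangle.
    no-fork : ∀ {a b y z} → Adj G a b ≡ true → Adj G b y ≡ true → y ≢ a → Adj G a z ≡ true → z ≡ b
    no-fork {a} {b} {y} {z} ab by y≢a az = decidable-stable (z Fin.≟ b) λ z≢b → triangle (meet az by (adjacent⇒≢ G ab) (y≢a ∘ sym) z≢b)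
      where
      triangle : z ≡ y → ⊥
      triangle refl
        with x , x∉ ← fresh (a ∷ b ∷ y ∷ []) 4≤n
        with t , xt ← neighbour x
        with t Fin.≟ a
      ... | yes refl = x∉ (there (there (here (meet (adjacent-sym xt) by (adjacent⇒≢ G ab) (y≢a ∘ sym) (x∉ ∘ there ∘ here)))))
      ... | no t≢a with refl ← meet xt ab (x∉ ∘ here) (x∉ ∘ there ∘ here) t≢a =
        x∉ (there (there (here (meet (adjacent-sym xt) az (adjacent⇒≢ G ab ∘ sym) (adjacent⇒≢ G by) (x∉ ∘ here)))))

    star : ∃[ c ] IsStar G c
    star with a , _ ← fresh {n} [] (ℕₚ.≤-trans (s≤s z≤n) 4≤n) with b , ab ← neighbour a
      with Finₚ.any? (λ y → (Adj G b y Bool.≟ true) ×-dec ¬? (y Fin.≟ a))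
    ... | no ¬∃               = a , star-at ab λ {y} by → decidable-stable (y Fin.≟ a) λ y≢a → ¬∃ (y , by , y≢a)
    ... | yes (y , by , y≢a)  = b , star-at (adjacent-sym ab) (no-fork ab by y≢a)

  -- False for three vertices: the triangle is no star and has no disjoint edges. For this reason
  -- the outcome `order-three` records `4 ≤ p + m`.
  star-or-disjointEdges : (∃[ c ] IsStar G c) ⊎ DisjointEdges G
  star-or-disjointEdges with disjointEdges? G
  ... | yes e = inj₂ e
  ... | no ¬e = inj₁ (star ¬e)

K1-spoke : ∀ {m} {v : Fin (suc m)} → v ≢ Fin.zero → Adj (K1 m) Fin.zero v ≡ true
K1-spoke {v = Fin.zero}  v≢0 = contradiction refl v≢0
K1-spoke {v = Fin.suc _} _   = refl

K1-leaves : ∀ {m} {u v : Fin (suc m)} → u ≢ Fin.zero → v ≢ Fin.zero → Adj (K1 m) u v ≡ false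
K1-leaves {u = Fin.zero}                  u≢0 _   = contradiction refl u≢0
K1-leaves {u = Fin.suc _} {v = Fin.zero}  _   v≢0 = contradiction refl v≢0
K1-leaves {u = Fin.suc _} {v = Fin.suc _} _   _   = refl

star⇒≅K1 : ∀ {m} {G : Graph (suc m)} {c} → IsStar G c → G ≅G K1 m
star⇒≅K1 {m} {G} {c} s = φ , λ u v → adj u v (u Fin.≟ c) (v Fin.≟ c)
  where
  open IsStar s
  φ : Permutation.Permutation (suc m) (suc m)
  φ = Permutation.transpose c Fin.zero
  open Inverse φ using (to; from; inverseʳ)
  to-c : to c ≡ Fin.zero
  to-c rewrite dec-true (c Fin.≟ c) refl = refl
  to-≢c : ∀ {u} → u ≢ c → to u ≢ Fin.zero
  to-≢c u≢c eq = u≢c (trans (sym (inverseʳ refl)) (trans (cong from (trans eq (sym to-c))) (inverseʳ refl)))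
  adj : ∀ u v → Dec (u ≡ c) → Dec (v ≡ c) → Adj G u v ≡ Adj (K1 m) (to u) (to v)
  adj u v (yes refl) (yes refl) = trans (irrefl G c) (sym (irrefl (K1 m) (to c)))
  adj u v (yes refl) (no v≢c)   = trans (spoke v≢c) (sym (trans (cong (λ z → Adj (K1 m) z (to v)) to-c) (K1-spoke (to-≢c v≢c))))
  adj u v (no u≢c)   (yes refl) = trans (Adj-sym G u c) (trans (spoke u≢c)
    (sym (trans (Adj-sym (K1 m) (to u) (to c)) (trans (cong (λ z → Adj (K1 m) z (to u)) to-c) (K1-spoke (to-≢c u≢c))))))
  adj u v (no u≢c)   (no v≢c)   = trans (leaves u≢c v≢c) (sym (K1-leaves (to-≢c u≢c) (to-≢c v≢c)))

≅K1⇒star : ∀ {m} {G : Graph (suc m)} → G ≅G K1 m → ∃[ c ] IsStar G c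
≅K1⇒star {m} {G} (φ , adj) = c , record
  { spoke  = λ {v} v≢c → trans (adj c v) (trans (cong (λ z → Adj (K1 m) z (to v)) (inverseˡ refl)) (K1-spoke (to-≢0 v≢c)))
  ; leaves = λ {u} {v} u≢c v≢c → trans (adj u v) (K1-leaves (to-≢0 u≢c) (to-≢0 v≢c)) }
  where
  open Inverse φ using (to; from; inverseˡ; inverseʳ)
  c : Fin (suc m)
  c = from Fin.zero
  to-≢0 : ∀ {v} → v ≢ c → to v ≢ Fin.zero
  to-≢0 v≢c eq = v≢c (sym (inverseʳ (sym eq)))

data Spread {n : ℕ} (G : Graph n) : Set where
  spread : ∀ {r} (walk : ∀ v → Reach G v r) → 2 ≤ count (sign ∘ walk) → 2 ≤ count (not ∘ sign ∘ walk) → Spread G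

-- Each of the two edges yields one vertex of each sign: the root is `a`, the walk from `b` is the
-- edge `ba`, and the walk from `d` goes to `c` and continues with the walk chosen for `c`, so that
-- its sign is opposite to that of `c`.
disjointEdges⇒spread : ∀ {n} {G : Graph n} → Connected G → DisjointEdges G → Spread G
disjointEdges⇒spread {n} {G} connected e = spread (proj₁ ∘ choice) (plus s refl) (minus s refl)
  where
  open DisjointEdges e
  a≢b : a ≢ b
  a≢b = adjacent⇒≢ G ab
  c≢d : c ≢ d
  c≢d = adjacent⇒≢ G cd
  c⇝a : Reach G c a
  c⇝a = connected c a
  s : Bool
  s = sign c⇝a
  Choice : Fin n → Set
  Choice v = Σ (Reach G v a) λ W → (v ≡ a → sign W ≡ false) × (v ≡ b → sign W ≡ true) × (v ≡ c → sign W ≡ s) × (v ≡ d → sign W ≡ not s)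
  choice : ∀ v → Choice v
  choice v with v Fin.≟ a | v Fin.≟ b | v Fin.≟ c | v Fin.≟ d
  ... | yes refl | _ | _ | _ = here , (λ _ → refl) , (λ eq → contradiction eq a≢b) , (λ eq → contradiction eq a≢c) , (λ eq → contradiction eq a≢d)
  ... | no v≢a | yes refl | _ | _ = step (trans (Adj-sym G b a) ab) here ,
    (λ eq → contradiction eq v≢a) , (λ _ → refl) , (λ eq → contradiction eq b≢c) , (λ eq → contradiction eq b≢d)
  ... | no v≢a | no v≢b | yes refl | _ = c⇝a ,
    (λ eq → contradiction eq v≢a) , (λ eq → contradiction eq v≢b) , (λ _ → refl) , (λ eq → contradiction eq c≢d)
  ... | no v≢a | no v≢b | no v≢c | yes refl = step (trans (Adj-sym G d c) cd) c⇝a ,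
    (λ eq → contradiction eq v≢a) , (λ eq → contradiction eq v≢b) , (λ eq → contradiction eq v≢c) , (λ _ → refl)
  ... | no v≢a | no v≢b | no v≢c | no v≢d = connected v a ,
    (λ eq → contradiction eq v≢a) , (λ eq → contradiction eq v≢b) , (λ eq → contradiction eq v≢c) , (λ eq → contradiction eq v≢d)
  σ : Fin n → Bool
  σ = sign ∘ proj₁ ∘ choice
  σa : σ a ≡ false
  σa = proj₁ (proj₂ (choice a)) refl
  σb : σ b ≡ true
  σb = proj₁ (proj₂ (proj₂ (choice b))) refl
  σc : σ c ≡ s
  σc = proj₁ (proj₂ (proj₂ (proj₂ (choice c)))) refl
  σd : σ d ≡ not s
  σd = proj₂ (proj₂ (proj₂ (proj₂ (choice d)))) refl
  plus : ∀ t → s ≡ t → 2 ≤ count σ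
  plus true  eq = count≥2 σ b≢c σb (trans σc eq)
  plus false eq = count≥2 σ b≢d σb (trans σd (cong not eq))
  minus : ∀ t → s ≡ t → 2 ≤ count (not ∘ σ)
  minus true  eq = count≥2 (not ∘ σ) a≢d (cong not σa) (cong not (trans σd (cong not eq)))
  minus false eq = count≥2 (not ∘ σ) a≢c (cong not σa) (cong not (trans σc eq))

-- Finite Abelian groups and balanced selections

-- The carrier is `Fin k` with propositional equality, so that elements can be listed, compared and
-- counted; an arbitrary group of order `k` is carried over by `Transport`.
record FinAbelianGroup (k : ℕ) : Set where
  infixl 7 _∙_
  infix  8 _⁻¹
  field
    _∙_            : Fin k → Fin k → Fin k
    ε              : Fin k
    _⁻¹            : Fin k → Fin k
    isAbelianGroup : IsAbelianGroup _≡_ _∙_ ε _⁻¹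

module FiniteGroup {k : ℕ} (Γ : FinAbelianGroup k) where
  open FinAbelianGroup Γ public

  C : Set
  C = Fin k

  group : AbelianGroup 0ℓ 0ℓ
  group = record { isAbelianGroup = isAbelianGroup }

  open AbelianGroup group using (assoc; comm; identityˡ; identityʳ; inverseˡ; inverseʳ; commutativeMonoid; commutativeSemigroup) public
  open AbelianGroupₚ group using (⁻¹-involutive; ∙-cancelˡ; ∙-cancelʳ; inverseˡ-unique; inverseʳ-unique; ⁻¹-∙-comm) public
  open CommutativeSemigroupₚ commutativeSemigroup using (interchange; x∙yz≈y∙xz) public

  ∑ : List C → C
  ∑ = foldr _∙_ ε

  ∑-++ : ∀ xs ys → ∑ (xs ++ ys) ≡ ∑ xs ∙ ∑ ys
  ∑-++ []       ys = sym (identityˡ _)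
  ∑-++ (x ∷ xs) ys = trans (cong (x ∙_) (∑-++ xs ys)) (sym (assoc x _ _))

  ∑-↭ : ∀ {xs ys} → xs ↭ ys → ∑ xs ≡ ∑ ys
  ∑-↭ _↭_.refl          = refl
  ∑-↭ (prep x p)        = cong (x ∙_) (∑-↭ p)
  ∑-↭ (swap x y p)      = trans (cong (λ z → x ∙ (y ∙ z)) (∑-↭ p)) (x∙yz≈y∙xz x y _)
  ∑-↭ (_↭_.trans p q)   = trans (∑-↭ p) (∑-↭ q)

  cancel-ε : ∀ {x y} → x ≡ x ∙ y → y ≡ ε
  cancel-ε {x} {y} eq = ∙-cancelˡ x y ε (trans (sym eq) (sym (identityʳ x)))

  Involutive : C → Set
  Involutive x = x ∙ x ≡ ε

  involutive? : ∀ x → Dec (Involutive x)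
  involutive? x = x ∙ x Fin.≟ ε

  involutive-∙ : ∀ {x y} → Involutive x → Involutive y → Involutive (x ∙ y)
  involutive-∙ {x} {y} xx yy = trans (interchange x y x y) (trans (cong₂ _∙_ xx yy) (identityˡ ε))

  involutive-∑ : ∀ {xs} → All Involutive xs → Involutive (∑ xs)
  involutive-∑ []       = identityˡ ε
  involutive-∑ (p ∷ ps) = involutive-∙ p (involutive-∑ ps)

  self-inverse : ∀ {x} → Involutive x → x ≡ x ⁻¹
  self-inverse {x} = inverseʳ-unique x x

  record Balanced (p m : ℕ) (xs : List C) : Set where
    constructor balanced
    field
      pos neg rest : List C
      perm         : pos ++ neg ++ rest ↭ xs
      length-pos   : length pos ≡ p
      length-neg   : length neg ≡ m
      ∑-eq         : ∑ pos ≡ ∑ neg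

  balanced-↭ : ∀ {p m xs ys} → xs ↭ ys → Balanced p m xs → Balanced p m ys
  balanced-↭ q (balanced P N R p a b c) = balanced P N R (↭-trans p q) a b c

  balanced-swap : ∀ {p m xs} → Balanced p m xs → Balanced m p xs
  balanced-swap (balanced P N R p a b c) = balanced N P R (↭-trans (↭ₚ.shifts N P) p) b a (sym c)

  balanced-skip : ∀ {p m xs} ys → Balanced p m xs → Balanced p m (ys ++ xs)
  balanced-skip ys (balanced P N R p a b c) = balanced P N (ys ++ R) perm a b c
    where
    perm : P ++ N ++ (ys ++ R) ↭ ys ++ _
    perm = ↭-trans (↭ₚ.++⁺ˡ P (↭ₚ.shifts N ys)) (↭-trans (↭ₚ.shifts P ys) (↭ₚ.++⁺ˡ ys p))

  pair : C → List C
  pair x = x ∷ x ⁻¹ ∷ []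

  ∑-pair : ∀ x → ∑ (pair x) ≡ ε
  ∑-pair x = trans (cong (x ∙_) (identityʳ _)) (inverseʳ x)

  pair-meet : ∀ {x y z} → z ∈ pair x → z ∈ pair y → y ∈ pair x
  pair-meet (here refl)         (here refl)         = here refl
  pair-meet {y = y} (here refl) (there (here refl)) = there (here (sym (⁻¹-involutive y)))
  pair-meet (there (here refl)) (here refl)         = there (here refl)
  pair-meet {x} {y} (there (here refl)) (there (here eq)) =
    here (trans (sym (⁻¹-involutive y)) (trans (cong _⁻¹ (sym eq)) (⁻¹-involutive x)))

  module Pairs = Blocks pair (λ _ → here refl) pair-meet
  open Pairs using () renaming (blocks to pairs) public

  length-pairs : ∀ ps → length (pairs ps) ≡ length ps * 2
  length-pairs []       = refl
  length-pairs (x ∷ ps) = cong (suc ∘ suc) (length-pairs ps)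

  ∑-pairs : ∀ ps → ∑ (pairs ps) ≡ ε
  ∑-pairs []       = refl
  ∑-pairs (x ∷ ps) = trans (∑-++ (pair x) (pairs ps)) (trans (cong₂ _∙_ (∑-pair x) (∑-pairs ps)) (identityˡ ε))

  balanced-pairˡ : ∀ {p m xs} x → Balanced p m xs → Balanced (2 + p) m (pair x ++ xs)
  balanced-pairˡ x (balanced P N R p a b c) = balanced (pair x ++ P) N R (prep x (prep (x ⁻¹) p)) (cong (suc ∘ suc) a) b
    (trans (∑-++ (pair x) P) (trans (cong₂ _∙_ (∑-pair x) c) (identityˡ _)))

  balanced-pairʳ : ∀ {p m xs} x → Balanced p m xs → Balanced p (2 + m) (pair x ++ xs)
  balanced-pairʳ x = balanced-swap ∘ balanced-pairˡ x ∘ balanced-swap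

  balanced-pairs : ∀ {p m xs} ps x y → x + y ≤ length ps → Balanced p m xs →
                   Balanced (x * 2 + p) (y * 2 + m) (pairs ps ++ xs)
  balanced-pairs ps       zero    zero    _       b = balanced-skip (pairs ps) b
  balanced-pairs (z ∷ ps) (suc x) y       (s≤s h) b = balanced-pairˡ z (balanced-pairs ps x y h b)
  balanced-pairs (z ∷ ps) zero    (suc y) (s≤s h) b = balanced-pairʳ z (balanced-pairs ps zero y h b)

  universe : List C
  universe = allFin k

  -- Pairs {x , - x} can be added to either side, so parities are all that matters beyond `base`;
  -- e is the number of group elements that may be left unused.
  balanced-base : ∀ {base c d p m} ps e x y → universe ↭ pairs ps ++ base → Balanced c d base →
                  p ≡ x * 2 + c → m ≡ y * 2 + d → e + (p + m) ≤ k → length base ≤ suc (e + (c + d)) →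
                  Balanced p m universe
  balanced-base {base} {c} {d} ps e x y perm b refl refl h l =
    balanced-↭ (↭-sym perm) (balanced-pairs ps x y (halves-≤ x y c d (length ps) (ℕₚ.+-cancelˡ-≤ e _ _ bound)) b)
    where
    k-eq : k ≡ length ps * 2 + length base
    k-eq = trans (sym (length-tabulate {n = k} (λ i → i)))
      (trans (↭ₚ.↭-length perm) (trans (length-++ (pairs ps)) (cong (_+ length base) (length-pairs ps))))
    bound : e + (x * 2 + c + (y * 2 + d)) ≤ e + suc (length ps * 2 + (c + d))
    bound = ℕₚ.≤-trans h (ℕₚ.≤-trans (ℕₚ.≤-reflexive k-eq)
      (ℕₚ.≤-trans (ℕₚ.+-monoʳ-≤ (length ps * 2) l)
        (ℕₚ.≤-reflexive (solve 3 (λ r e s → r :+ (con 1 :+ (e :+ s)) := e :+ (con 1 :+ (r :+ s))) refl (length ps * 2) e (c + d)))))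
      where open +-*-Solver

  involutions noninvolutions : List C
  involutions    = filter involutive? universe
  noninvolutions = filter (∁? involutive?) universe

  universe-split : universe ↭ involutions ++ noninvolutions
  universe-split = filter-split involutive? universe

  ∈-involutions : ∀ {x} → Involutive x → x ∈ involutions
  ∈-involutions {x} = ∈-filter⁺ involutive? (∈-allFin x)

  ∈-noninvolutions : ∀ {x} → ¬ Involutive x → x ∈ noninvolutions
  ∈-noninvolutions {x} = ∈-filter⁺ (∁? involutive?) (∈-allFin x)

  involutions⁻ : ∀ {x} → x ∈ involutions → Involutive x
  involutions⁻ = proj₂ ∘ ∈-filter⁻ involutive? {xs = universe}

  noninvolutions⁻ : ∀ {x} → x ∈ noninvolutions → ¬ Involutive x
  noninvolutions⁻ = proj₂ ∘ ∈-filter⁻ (∁? involutive?) {xs = universe}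

  involutions-unique : Unique involutions
  involutions-unique = Uniqueₚ.filter⁺ involutive? (Uniqueₚ.allFin⁺ k)

  involutive-⁻¹ : ∀ {x} → Involutive (x ⁻¹) → Involutive x
  involutive-⁻¹ {x} p = trans (cong₂ _∙_ x≡ x≡) p
    where
    x≡ : x ≡ x ⁻¹
    x≡ = trans (sym (⁻¹-involutive x)) (sym (self-inverse p))

  noninvolutions-closed : Pairs.Closed noninvolutions
  noninvolutions-closed = record
    { unique = Uniqueₚ.filter⁺ (∁? involutive?) (Uniqueₚ.allFin⁺ k)
    ; block-unique = λ {x} x∈ → ((λ eq → noninvolutions⁻ x∈ (trans (cong (x ∙_) eq) (inverseʳ x))) ∷ []) ∷ [] ∷ []
    ; block-⊆ = λ { x∈ (here refl) → x∈ ; x∈ (there (here refl)) → ∈-noninvolutions (noninvolutions⁻ x∈ ∘ involutive-⁻¹) }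
    }

  paired : ∃[ ps ] noninvolutions ↭ pairs ps
  paired = Pairs.decompose noninvolutions-closed

  ε-involutive : Involutive ε
  ε-involutive = identityˡ ε

  ε-first : ∃[ xs ] involutions ↭ ε ∷ xs
  ε-first = ∈⇒↭∷ (∈-involutions ε-involutive)

  -- Exponent dividing 2 or 3; these groups are identified with powers of ℤ₂ or ℤ₃ only at the end,
  -- by `elementary-isomorphism`.
  OrderTwo OrderThree : Set
  OrderTwo   = ∀ x → x ∙ x ≡ ε
  OrderThree = ∀ x → x ∙ (x ∙ x) ≡ ε

  universe-pairs : ∀ {xs} → involutions ↭ xs → ∀ ps → noninvolutions ↭ pairs ps → universe ↭ pairs ps ++ xs
  universe-pairs p ps q = ↭-trans universe-split (↭-trans (↭ₚ.++⁺ p q) (↭ₚ.++-comm _ (pairs ps)))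

  universe-length : ∀ {xs} → universe ↭ xs → k ≡ length xs
  universe-length p = trans (sym (length-tabulate {n = k} (λ i → i))) (↭ₚ.↭-length p)

  remaining-∈ : ∀ {bs xs ys} {y : C} → xs ↭ bs ++ ys → y ∈ xs → y ∉ bs → y ∈ ys
  remaining-∈ {bs} p y∈ y∉ = [ (λ q → contradiction q y∉) , (λ q → q) ]′ (∈-++⁻ bs (↭ₚ.∈-resp-↭ p y∈))

  nonempty : ∀ {xs base} → universe ↭ xs ++ base → length base < k → ∃[ x ] x ∈ xs
  nonempty {[]}     p lt = contradiction (sym (universe-length p)) (ℕₚ.<⇒≢ lt)
  nonempty {x ∷ xs} p lt = x , here refl

  -- Groups with at most one element of order two

  data BothOdd : ℕ → ℕ → Set where
    both-odd : ∀ x y → BothOdd (x * 2 + 1) (y * 2 + 1)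

  -- The neutral element fills one odd side, and no other involution is used. It cannot serve two
  -- sides, so two odd numbers are left for the sequel.
  few-involutions : ∀ {rest} → involutions ↭ ε ∷ rest → length rest ≤ 1 → ∀ p m → p + m < k →
                    Balanced p m universe ⊎ BothOdd p m
  few-involutions {rest} perm l p m lt
    with ps , q ← paired
    with half p | half m
  ... | odd x  | odd y  = inj₂ (both-odd x y)
  ... | even x | even y = inj₁ (balanced-base ps 1 x y (universe-pairs perm ps q)
                            (balanced [] [] (ε ∷ rest) ↭-refl refl refl refl) refl refl lt (s≤s l))
  ... | odd x  | even y = inj₁ (balanced-base ps 1 x y (universe-pairs perm ps q)
                            (balanced (ε ∷ []) [] rest ↭-refl refl refl ε-involutive) refl refl lt (ℕₚ.m≤n⇒m≤1+n (s≤s l)))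
  ... | even x | odd y  = inj₁ (balanced-base ps 1 x y (universe-pairs perm ps q)
                            (balanced [] (ε ∷ []) rest ↭-refl refl refl (sym ε-involutive)) refl refl lt (ℕₚ.m≤n⇒m≤1+n (s≤s l)))

  -- The sides are interchangeable, and two odd numbers with sum at least 3 cannot both be 1; so one
  -- side may be assumed to need three elements.
  both-odd-balanced : (∀ x y → x * 2 + 3 + (y * 2 + 1) < k → Balanced (x * 2 + 3) (y * 2 + 1) universe) →
                      ∀ {p m} → BothOdd p m → 3 ≤ p + m → p + m < k → Balanced p m universe
  both-odd-balanced f (both-odd (suc x) y) _ lt =
    subst (λ p → Balanced p (y * 2 + 1) universe) (sym (suc-odd x)) (f x y (subst (λ p → p + (y * 2 + 1) < k) (suc-odd x) lt))
  both-odd-balanced f (both-odd zero (suc y)) _ lt = balanced-swap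
    (subst (λ p → Balanced p 1 universe) (sym (suc-odd y)) (f y 0 (subst (_< k) (trans (ℕₚ.+-comm 1 (suc y * 2 + 1)) (cong (_+ 1) (suc-odd y))) lt)))
  both-odd-balanced f (both-odd zero zero) (s≤s (s≤s ())) _

  five-≤ : ∀ x y → x * 2 + 3 + (y * 2 + 1) < k → 5 ≤ k
  five-≤ x y lt = ℕₚ.≤-trans (s≤s (ℕₚ.+-mono-≤ (ℕₚ.m≤n+m 3 (x * 2)) (ℕₚ.m≤n+m 1 (y * 2)))) lt

  extend-pair : ∀ {x xs ys base} → xs ↭ pair x ++ ys → universe ↭ xs ++ base → universe ↭ ys ++ (pair x ++ base)
  extend-pair {x} {ys = ys} {base} p q = ↭-trans q (↭-trans (↭ₚ.++⁺ʳ base p) (↭-trans (↭ₚ.++⁺ʳ base (↭ₚ.++-comm (pair x) ys)) (↭-reflexive (++-assoc ys (pair x) base))))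

  -- Primed letters stand for inverses; the list has the order in which `extend-pair` stacks pairs
  -- upon the involutions.
  balanced-3-1-of-7 : ∀ {a b c a′ b′ c′ e} → a ∙ (b ∙ (c′ ∙ ε)) ≡ e ∙ ε →
            Balanced 3 1 (c ∷ c′ ∷ b ∷ b′ ∷ a ∷ a′ ∷ e ∷ [])
  balanced-3-1-of-7 {a} {b} {c} {a′} {b′} {c′} {e} = balanced (a ∷ b ∷ c′ ∷ []) (e ∷ []) (a′ ∷ b′ ∷ c ∷ [])
    (∷↭++∷ (c ∷ c′ ∷ b ∷ b′ ∷ []) (∷↭++∷ (c ∷ c′ ∷ []) (∷↭++∷ (c ∷ []) (∷↭++∷ (c ∷ b′ ∷ a′ ∷ []) (∷↭++∷ (c ∷ b′ ∷ []) (∷↭++∷ (c ∷ []) ↭-refl)))))) refl refl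

  balanced-3-1-of-5 : ∀ {a b a′ b′ e} → e ∙ (a′ ∙ (b ∙ ε)) ≡ a ∙ ε → Balanced 3 1 (b ∷ b′ ∷ a ∷ a′ ∷ e ∷ [])
  balanced-3-1-of-5 {a} {b} {a′} {b′} {e} = balanced (e ∷ a′ ∷ b ∷ []) (a ∷ []) (b′ ∷ [])
    (∷↭++∷ (b ∷ b′ ∷ a ∷ a′ ∷ []) (∷↭++∷ (b ∷ b′ ∷ a ∷ []) (prep _ (∷↭++∷ (b′ ∷ []) ↭-refl)))) refl refl

  balanced-3-3-of-7 : ∀ {a b c a′ b′ c′ e} → a ∙ (b ∙ (e ∙ ε)) ≡ a′ ∙ (b′ ∙ (c′ ∙ ε)) →
            Balanced 3 3 (c ∷ c′ ∷ b ∷ b′ ∷ a ∷ a′ ∷ e ∷ [])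
  balanced-3-3-of-7 {a} {b} {c} {a′} {b′} {c′} {e} = balanced (a ∷ b ∷ e ∷ []) (a′ ∷ b′ ∷ c′ ∷ []) (c ∷ [])
    (∷↭++∷ (c ∷ c′ ∷ b ∷ b′ ∷ []) (∷↭++∷ (c ∷ c′ ∷ []) (∷↭++∷ (c ∷ c′ ∷ b′ ∷ a′ ∷ []) (∷↭++∷ (c ∷ c′ ∷ b′ ∷ []) (∷↭++∷ (c ∷ c′ ∷ []) (∷↭++∷ (c ∷ []) ↭-refl)))))) refl refl

  two-pairs : ∀ {a b base} → universe ↭ noninvolutions ++ base → ¬ Involutive a → ¬ Involutive b → b ∉ pair a →
              ∃[ ps ] universe ↭ pairs ps ++ (pair b ++ (pair a ++ base))
  two-pairs {a} {b} start a² b² b∉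
    with R₁ , p₁ , c₁ ← Pairs.split-block noninvolutions-closed (∈-noninvolutions a²)
    with R₂ , p₂ , c₂ ← Pairs.split-block c₁ (remaining-∈ p₁ (∈-noninvolutions b²) b∉)
    with ps , q ← Pairs.decompose c₂
    = ps , ↭-trans (extend-pair p₂ (extend-pair p₁ start)) (↭ₚ.++⁺ʳ _ q)

  module NoInvolution (perm : involutions ↭ ε ∷ []) where

    involutive⇒ε : ∀ {x} → Involutive x → x ≡ ε
    involutive⇒ε p with ↭ₚ.∈-resp-↭ perm (∈-involutions p)
    ... | here eq = eq

    nonε : ∀ {x} → x ≢ ε → x ∈ noninvolutions
    nonε x≢ε = ∈-noninvolutions (x≢ε ∘ involutive⇒ε)

    start : universe ↭ noninvolutions ++ (ε ∷ [])
    start = ↭-trans universe-split (↭-trans (↭ₚ.++⁺ʳ _ perm) (↭ₚ.++-comm (ε ∷ []) _))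

    ≢ε : ∀ {x} → x ∈ noninvolutions → x ≢ ε
    ≢ε x∈ refl = noninvolutions⁻ x∈ ε-involutive

    -- {0 , - a , 2a} against {a}; only - 2a is wasted.
    balanced-3-1 : ∀ {a} → a ∙ (a ∙ a) ≢ ε → ∀ x y → x * 2 + 3 + (y * 2 + 1) < k →
                  Balanced (x * 2 + 3) (y * 2 + 1) universe
    balanced-3-1 {a} a³ x y lt = uncurry from pairing
      where
      sums : ε ∙ (a ⁻¹ ∙ ((a ∙ a) ∙ ε)) ≡ a ∙ ε
      sums = trans (identityˡ _) (trans (cong (a ⁻¹ ∙_) (assoc a a ε))
        (trans (sym (assoc _ _ _)) (trans (cong (_∙ (a ∙ ε)) (inverseˡ a)) (identityˡ _))))
      from : ∀ ps → universe ↭ pairs ps ++ _ → Balanced (x * 2 + 3) (y * 2 + 1) universe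
      from ps perm = balanced-base ps 1 x y perm (balanced-3-1-of-5 sums) refl refl lt (ℕₚ.n≤1+n 5)
      a≢ε : a ≢ ε
      a≢ε a≡ε = a³ (trans (cong (λ z → z ∙ (z ∙ z)) a≡ε) (trans (cong (ε ∙_) ε-involutive) ε-involutive))
      aa∉ : a ∙ a ∉ pair a
      aa∉ (here eq)         = a≢ε (cancel-ε (sym eq))
      aa∉ (there (here eq)) = a³ (trans (cong (a ∙_) eq) (inverseʳ a))
      pairing : ∃[ ps ] universe ↭ pairs ps ++ (pair (a ∙ a) ++ (pair a ++ (ε ∷ [])))
      pairing = two-pairs start (a≢ε ∘ involutive⇒ε) (a≢ε ∘ involutive⇒ε ∘ involutive⇒ε) aa∉

    module _ (order-3 : OrderThree) where

      ⁻¹-square : ∀ x → x ⁻¹ ∙ x ⁻¹ ≡ x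
      ⁻¹-square x = trans (inverseʳ-unique _ _ (order-3 (x ⁻¹))) (⁻¹-involutive x)

      square : ∀ x → x ∙ x ≡ x ⁻¹
      square x = inverseʳ-unique _ _ (order-3 x)

      record Independent : Set where
        field
          a b  : C
          ps   : List C
          perm₇ : universe ↭ pairs ps ++ (pair (a ∙ b) ++ (pair b ++ (pair a ++ (ε ∷ []))))

      independent : 5 ≤ k → Independent
      independent 5≤k
        with a , a∈ ← nonempty start (ℕₚ.≤-trans (s≤s (s≤s z≤n)) 5≤k)
        with R₁ , p₁ , c₁ ← Pairs.split-block noninvolutions-closed a∈
        with b , b∈₁ ← nonempty (extend-pair p₁ start) (ℕₚ.≤-trans (s≤s (s≤s (s≤s (s≤s z≤n)))) 5≤k)
        with R₂ , p₂ , c₂ ← Pairs.split-block c₁ b∈₁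
        with b∉ ← (λ b∈a → Unique-++-disjoint (pair a) (Unique-resp-↭ p₁ (Pairs.Closed.unique noninvolutions-closed)) b∈a b∈₁)
        with b≢ε ← ≢ε (↭ₚ.∈-resp-↭ (↭-sym p₁) (∈-++⁺ʳ (pair a) b∈₁))
        -- It has to be seen that `a ∙ b` is none of 0, ± a, ± b. As - a = 2a, the equation a + b =
        -- - a would give b = a, and symmetrically for `b`.
        with R₃ , p₃ , c₃ ← Pairs.split-block {a ∙ b} c₂
          (remaining-∈ p₂ (remaining-∈ p₁
            (nonε λ eq → b∉ (there (here (inverseʳ-unique _ _ eq))))
            λ { (here eq) → b≢ε (cancel-ε (sym eq))
              ; (there (here eq)) → b∉ (here (∙-cancelˡ a _ _ (trans eq (sym (square a))))) })
            λ { (here eq) → ≢ε a∈ (cancel-ε (trans (sym eq) (comm a b)))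
              ; (there (here eq)) → b∉ (here (sym (∙-cancelʳ b _ _ (trans eq (sym (square b)))))) })
        with ps , q ← Pairs.decompose c₃
        = record { a = a ; b = b ; ps = ps
                 ; perm₇ = ↭-trans (extend-pair p₃ (extend-pair p₂ (extend-pair p₁ start))) (↭ₚ.++⁺ʳ _ q) }

      -- {a , b , - (a + b)} against {0}.
      order-three-3-1 : Independent → ∀ x y → 2 + (x * 2 + 3 + (y * 2 + 1)) ≤ k → Balanced (x * 2 + 3) (y * 2 + 1) universe
      order-three-3-1 ind x y lt = balanced-base ps 2 x y perm₇ (balanced-3-1-of-7 sums) refl refl lt ℕₚ.≤-refl
        where
        open Independent ind
        sums : a ∙ (b ∙ ((a ∙ b) ⁻¹ ∙ ε)) ≡ ε ∙ ε
        sums = begin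
          a ∙ (b ∙ ((a ∙ b) ⁻¹ ∙ ε)) ≡⟨ cong (λ z → a ∙ (b ∙ z)) (identityʳ ((a ∙ b) ⁻¹)) ⟩
          a ∙ (b ∙ (a ∙ b) ⁻¹)       ≡⟨ assoc a b ((a ∙ b) ⁻¹) ⟨
          a ∙ b ∙ (a ∙ b) ⁻¹         ≡⟨ inverseʳ (a ∙ b) ⟩
          ε                          ≡⟨ ε-involutive ⟨
          ε ∙ ε                      ∎
          where open ≡-Reasoning

      -- {a , b , 0} against {- a , - b , - (a + b)}, both with sum a + b.
      order-three-3-3 : Independent → ∀ x y → x * 2 + 3 + (y * 2 + 3) < k → Balanced (x * 2 + 3) (y * 2 + 3) universe
      order-three-3-3 ind x y lt = balanced-base ps 1 x y perm₇ (balanced-3-3-of-7 sums) refl refl lt (ℕₚ.n≤1+n 7)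
        where
        open Independent ind
        sums : a ∙ (b ∙ (ε ∙ ε)) ≡ a ⁻¹ ∙ (b ⁻¹ ∙ ((a ∙ b) ⁻¹ ∙ ε))
        sums = begin
          a ∙ (b ∙ (ε ∙ ε))                 ≡⟨ cong (λ z → a ∙ (b ∙ z)) ε-involutive ⟩
          a ∙ (b ∙ ε)                       ≡⟨ cong (a ∙_) (identityʳ b) ⟩
          a ∙ b                             ≡⟨ ⁻¹-square (a ∙ b) ⟨
          (a ∙ b) ⁻¹ ∙ (a ∙ b) ⁻¹           ≡⟨ cong (_∙ (a ∙ b) ⁻¹) (⁻¹-∙-comm a b) ⟨
          a ⁻¹ ∙ b ⁻¹ ∙ (a ∙ b) ⁻¹          ≡⟨ assoc (a ⁻¹) (b ⁻¹) ((a ∙ b) ⁻¹) ⟩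
          a ⁻¹ ∙ (b ⁻¹ ∙ (a ∙ b) ⁻¹)        ≡⟨ cong (λ z → a ⁻¹ ∙ (b ⁻¹ ∙ z)) (identityʳ ((a ∙ b) ⁻¹)) ⟨
          a ⁻¹ ∙ (b ⁻¹ ∙ ((a ∙ b) ⁻¹ ∙ ε))  ∎
          where open ≡-Reasoning

  balanced-3-1-of-6 : ∀ {a b a′ b′ e i} → e ∙ (i ∙ (a ∙ ε)) ≡ b ∙ ε → Balanced 3 1 (b ∷ b′ ∷ a ∷ a′ ∷ e ∷ i ∷ [])
  balanced-3-1-of-6 {a} {b} {a′} {b′} {e} {i} = balanced (e ∷ i ∷ a ∷ []) (b ∷ []) (a′ ∷ b′ ∷ [])
    (∷↭++∷ (b ∷ b′ ∷ a ∷ a′ ∷ []) (∷↭++∷ (b ∷ b′ ∷ a ∷ a′ ∷ []) (∷↭++∷ (b ∷ b′ ∷ []) (prep _ (∷↭++∷ (b′ ∷ []) ↭-refl))))) refl refl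

  module OneInvolution {ι : C} (perm : involutions ↭ ε ∷ ι ∷ []) where

    ι-involutive : Involutive ι
    ι-involutive = involutions⁻ (↭ₚ.∈-resp-↭ (↭-sym perm) (there (here refl)))

    start : universe ↭ noninvolutions ++ (ε ∷ ι ∷ [])
    start = ↭-trans universe-split (↭-trans (↭ₚ.++⁺ʳ _ perm) (↭ₚ.++-comm (ε ∷ ι ∷ []) _))

    involutive⇒ : ∀ {x} → Involutive x → x ≢ ε → x ≡ ι
    involutive⇒ p x≢ε with ↭ₚ.∈-resp-↭ perm (∈-involutions p)
    ... | here eq         = contradiction eq x≢ε
    ... | there (here eq) = eq

    ι≢ε : ι ≢ ε
    ι≢ε refl = Uniqueₚ.Unique[x∷xs]⇒x∉xs (Unique-resp-↭ perm involutions-unique) (here refl)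

    -- Both doubles are the only element of order two, so a + b doubles to 0; it is therefore 0 or
    -- `ι`, and `ι` equals `a ∙ a`.
    order-4-pair : ∀ {a b} → ¬ Involutive a → ¬ Involutive b → Involutive (a ∙ a) → Involutive (b ∙ b) → b ∈ pair a
    order-4-pair {a} {b} a² b² a⁴ b⁴ = go (a ∙ b Fin.≟ ε)
      where
      ab² : Involutive (a ∙ b)
      ab² = trans (interchange a b a b) (trans (cong₂ _∙_ (involutive⇒ a⁴ a²) (involutive⇒ b⁴ b²)) ι-involutive)
      go : Dec (a ∙ b ≡ ε) → b ∈ pair a
      go (yes ab≡ε) = there (here (inverseʳ-unique a b ab≡ε))
      go (no ab≢ε)  = here (∙-cancelˡ a b a (trans (involutive⇒ ab² ab≢ε) (sym (involutive⇒ a⁴ a²))))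

    -- The doubles of a and b can both equal ι only if b = ± a.
    not-order-4 : 5 ≤ k → ∃[ a ] ¬ Involutive (a ∙ a)
    not-order-4 5≤k
      with a , a∈ ← nonempty start (ℕₚ.≤-trans (s≤s (s≤s (s≤s z≤n))) 5≤k)
      with R₁ , p₁ , c₁ ← Pairs.split-block noninvolutions-closed a∈
      with b , b∈₁ ← nonempty (extend-pair p₁ start) 5≤k
      = go (involutive? (a ∙ a)) (involutive? (b ∙ b))
      where
      b∉ : b ∉ pair a
      b∉ b∈a = Unique-++-disjoint (pair a) (Unique-resp-↭ p₁ (Pairs.Closed.unique noninvolutions-closed)) b∈a b∈₁
      b∈ : b ∈ noninvolutions
      b∈ = ↭ₚ.∈-resp-↭ (↭-sym p₁) (∈-++⁺ʳ (pair a) b∈₁)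
      go : Dec (Involutive (a ∙ a)) → Dec (Involutive (b ∙ b)) → ∃[ a ] ¬ Involutive (a ∙ a)
      go (no a⁴)  _        = a , a⁴
      go (yes _)  (no b⁴)  = b , b⁴
      go (yes a⁴) (yes b⁴) = contradiction (order-4-pair (noninvolutions⁻ a∈) (noninvolutions⁻ b∈) a⁴ b⁴) b∉

    squared : ∀ {a} → a ∙ ι ≡ a ⁻¹ → a ∙ a ≡ ι
    squared {a} eq = trans (inverseˡ-unique _ ι (trans (assoc a a ι) (trans (cong (a ∙_) eq) (inverseʳ a)))) (sym (self-inverse ι-involutive))

    -- {0 , ι , a} against {a + ι}.
    balanced-3-1 : ∀ x y → x * 2 + 3 + (y * 2 + 1) < k → Balanced (x * 2 + 3) (y * 2 + 1) universe
    balanced-3-1 x y lt = uncurry from (not-order-4 (five-≤ x y lt))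
      where
      from : ∀ a → ¬ Involutive (a ∙ a) → Balanced (x * 2 + 3) (y * 2 + 1) universe
      from a a⁴ = uncurry from′ pairing
        where
        sums : ε ∙ (ι ∙ (a ∙ ε)) ≡ a ∙ ι ∙ ε
        sums = trans (identityˡ _) (trans (x∙yz≈y∙xz ι a ε) (sym (assoc a ι ε)))
        from′ : ∀ ps → universe ↭ pairs ps ++ _ → Balanced (x * 2 + 3) (y * 2 + 1) universe
        from′ ps perm = balanced-base ps 1 x y perm (balanced-3-1-of-6 sums) refl refl lt ℕₚ.≤-refl
        a² : ¬ Involutive a
        a² eq = a⁴ (trans (cong₂ _∙_ eq eq) ε-involutive)
        aι² : ¬ Involutive (a ∙ ι)
        aι² eq = a² (trans (sym (trans (interchange a ι a ι) (trans (cong (a ∙ a ∙_) ι-involutive) (identityʳ _)))) eq)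
        -- The equation a + ι = - a means 2a = ι, so an `a` of order 4 would not do.
        aι∉ : a ∙ ι ∉ pair a
        aι∉ (here eq)         = ι≢ε (cancel-ε (sym eq))
        aι∉ (there (here eq)) = a⁴ (trans (cong (λ z → z ∙ z) (squared eq)) ι-involutive)
        pairing : ∃[ ps ] universe ↭ pairs ps ++ (pair (a ∙ ι) ++ (pair a ++ (ε ∷ ι ∷ [])))
        pairing = two-pairs start a² aι² aι∉

  -- p and m are the numbers of vertices of each sign, p + m the order of the graph.
  data Outcome (p m : ℕ) : Set where
    success     : Balanced p m universe → Outcome p m
    order-three : OrderThree → suc (p + m) ≡ k → 4 ≤ p + m → p ≡ 1 ⊎ m ≡ 1 → Outcome p m
    order-two   : OrderTwo → 2 + (p + m) ≡ k → Outcome p m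

  outcome-swap : ∀ {p m} → Outcome p m → Outcome m p
  outcome-swap         (success b)             = success (balanced-swap b)
  outcome-swap {p} {m} (order-three o eq h pm) =
    order-three o (trans (cong suc (ℕₚ.+-comm m p)) eq) (ℕₚ.≤-trans h (ℕₚ.≤-reflexive (ℕₚ.+-comm p m))) (Sum.swap pm)
  outcome-swap {p} {m} (order-two o eq)        = order-two o (trans (cong (2 +_) (ℕₚ.+-comm m p)) eq)

  noninvolutions-empty : noninvolutions ↭ [] → universe ↭ involutions
  noninvolutions-empty p = ↭-trans universe-split (↭-trans (↭ₚ.++⁺ˡ involutions p) (↭-reflexive (++-identityʳ _)))

  -- Zero-sum sets and groups with several elements of order two

  record ZeroSum (i : ℕ) (xs : List C) : Set where
    constructor zero-sum
    field
      sel rest   : List C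
      perm       : sel ++ rest ↭ xs
      length-sel : length sel ≡ i
      ∑-sel      : ∑ sel ≡ ε

  zeroSum-↭ : ∀ {i xs ys} → xs ↭ ys → ZeroSum i xs → ZeroSum i ys
  zeroSum-↭ q (zero-sum S R p l s) = zero-sum S R (↭-trans p q) l s

  zeroSum-complement : ∀ {i j xs} → ∑ xs ≡ ε → length xs ≡ i + j → ZeroSum i xs → ZeroSum j xs
  zeroSum-complement {i} {j} {xs} ∑xs lxs (zero-sum S R p l s) = zero-sum R S (↭-trans (↭ₚ.++-comm R S) p)
    (ℕₚ.+-cancelˡ-≡ i _ _ (trans (cong (_+ length R) (sym l)) (trans (sym (length-++ S)) (trans (↭ₚ.↭-length p) lxs))))
    (trans (sym (identityˡ (∑ R))) (trans (cong (_∙ ∑ R) (sym s)) (trans (sym (∑-++ S R)) (trans (∑-↭ p) ∑xs))))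

  -- Signs do not matter for involutions, so any split of a zero-sum set is balanced.
  zeroSum⇒balanced : ∀ p m {xs} → All Involutive xs → ZeroSum (p + m) xs → Balanced p m xs
  zeroSum⇒balanced p m {xs} inv (zero-sum S R perm l s) =
    balanced (take p S) (drop p S) R
      (↭-trans (↭-reflexive (trans (sym (++-assoc (take p S) _ R)) (cong (_++ R) (take++drop≡id p S)))) perm)
      (trans (length-take p S) (trans (cong (p ℕ.⊓_) l) (ℕₚ.m≤n⇒m⊓n≡m (ℕₚ.m≤m+n p m))))
      (trans (length-drop p S) (trans (cong (ℕ._∸ p) l) (ℕₚ.m+n∸m≡n p m)))
      (trans (inverseˡ-unique _ _ (trans (sym (∑-++ (take p S) (drop p S))) (trans (cong ∑ (take++drop≡id p S)) s)))
             (sym (self-inverse (involutive-∑ (Allₚ.drop⁺ p (Allₚ.++⁻ˡ S (↭ₚ.All-resp-↭ (↭-sym perm) inv)))))))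

  -- An element and its inverse must go to the same side, which needs two places there; among at
  -- least two places only the distribution 1 + 1 offers none.
  use-pair : ∀ x p m {xs} → 2 ≤ p + m → ¬ (p ≡ 1 × m ≡ 1) →
             (∀ p′ m′ → 2 + (p′ + m′) ≡ p + m → Balanced p′ m′ xs) → Balanced p m (pair x ++ xs)
  use-pair x (suc (suc p)) m             _        _  f = balanced-pairˡ x (f p m refl)
  use-pair x 0             (suc (suc m)) _        _  f = balanced-pairʳ x (f 0 m refl)
  use-pair x 0             1             (s≤s ()) _  f
  use-pair x 1             (suc (suc m)) _        _  f = balanced-pairʳ x (f 1 m refl)
  use-pair x 1             1             _        ¬1 f = contradiction (refl , refl) ¬1
  use-pair x 1             0             (s≤s ()) _  f

  module ManyInvolutions {a b : C} (aa : Involutive a) (bb : Involutive b)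
                         (a≢ε : a ≢ ε) (b≢ε : b ≢ ε) (b≢a : b ≢ a) where

    scalar : Bool → C → C
    scalar i x = if i then x else ε

    scalar-xor : ∀ {x} → Involutive x → ∀ i j → scalar i x ∙ scalar j x ≡ scalar (i xor j) x
    scalar-xor xx false false = ε-involutive
    scalar-xor xx false true  = identityˡ _
    scalar-xor xx true  false = identityʳ _
    scalar-xor xx true  true  = xx

    -- The Klein four-group spanned by `a` and `b`, indexed by pairs of bits so that its addition
    -- becomes `xor`.
    v : Bool → Bool → C
    v i j = scalar i a ∙ scalar j b

    v-∙ : ∀ i j i′ j′ → v i j ∙ v i′ j′ ≡ v (i xor i′) (j xor j′)
    v-∙ i j i′ j′ = trans (interchange (scalar i a) (scalar j b) (scalar i′ a) (scalar j′ b)) (cong₂ _∙_ (scalar-xor aa i i′) (scalar-xor bb j j′))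

    scalar-involutive : ∀ {x} → Involutive x → ∀ i → Involutive (scalar i x)
    scalar-involutive xx false = ε-involutive
    scalar-involutive xx true  = xx

    v-involutive : ∀ i j → Involutive (v i j)
    v-involutive i j = involutive-∙ (scalar-involutive aa i) (scalar-involutive bb j)

    quad : C → List C
    quad x = x ∷ x ∙ a ∷ x ∙ b ∷ x ∙ (a ∙ b) ∷ []

    ∈-quad⁻ : ∀ {x z} → z ∈ quad x → ∃[ i ] ∃[ j ] z ≡ x ∙ v i j
    ∈-quad⁻ {x} (here eq)                         = false , false , trans eq (trans (sym (identityʳ x)) (cong (x ∙_) (sym ε-involutive)))
    ∈-quad⁻ {x} (there (here eq))                 = true  , false , trans eq (cong (x ∙_) (sym (identityʳ a)))
    ∈-quad⁻ {x} (there (there (here eq)))         = false , true  , trans eq (cong (x ∙_) (sym (identityˡ b)))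
    ∈-quad⁻ {x} (there (there (there (here eq)))) = true  , true  , eq

    ∈-quad⁺ : ∀ {x z} i j → z ≡ x ∙ v i j → z ∈ quad x
    ∈-quad⁺ {x} false false eq = here (trans eq (trans (cong (x ∙_) ε-involutive) (identityʳ x)))
    ∈-quad⁺ {x} true  false eq = there (here (trans eq (cong (x ∙_) (identityʳ a))))
    ∈-quad⁺ {x} false true  eq = there (there (here (trans eq (cong (x ∙_) (identityˡ b)))))
    ∈-quad⁺ {x} true  true  eq = there (there (there (here eq)))

    quad-meet : ∀ {x y z} → z ∈ quad x → z ∈ quad y → y ∈ quad x
    quad-meet {x} {y} {z} z∈x z∈y
      with i , j , p ← ∈-quad⁻ z∈x
      with i′ , j′ , q ← ∈-quad⁻ z∈y
      = ∈-quad⁺ (i xor i′) (j xor j′) (begin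
        y                         ≡⟨ identityʳ y ⟨
        y ∙ ε                     ≡⟨ cong (y ∙_) (v-involutive i′ j′) ⟨
        y ∙ (v i′ j′ ∙ v i′ j′)   ≡⟨ assoc y _ _ ⟨
        y ∙ v i′ j′ ∙ v i′ j′     ≡⟨ cong (_∙ v i′ j′) (trans (sym q) p) ⟩
        x ∙ v i j ∙ v i′ j′       ≡⟨ assoc x _ _ ⟩
        x ∙ (v i j ∙ v i′ j′)     ≡⟨ cong (x ∙_) (v-∙ i j i′ j′) ⟩
        x ∙ v (i xor i′) (j xor j′) ∎)
      where open ≡-Reasoning

    module Quads = Blocks quad (λ _ → here refl) quad-meet
    open Quads using () renaming (blocks to quads) public

    quad-unique : ∀ x → Unique (quad x)
    quad-unique x = (a≢ε ∘ cancel-ε ∷ b≢ε ∘ cancel-ε ∷ ab≢ε ∘ cancel-ε ∷ [])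
                  ∷ (b≢a ∘ sym ∘ ∙-cancelˡ x a b ∷ (λ eq → b≢ε (cancel-ε (∙-cancelˡ x a (a ∙ b) eq))) ∷ [])
                  ∷ ((λ eq → a≢ε (cancel-ε (trans (∙-cancelˡ x b (a ∙ b) eq) (comm a b)))) ∷ [])
                  ∷ [] ∷ []
      where
      ab≢ε : a ∙ b ≢ ε
      ab≢ε eq = b≢a (trans (inverseʳ-unique a b eq) (sym (self-inverse aa)))

    quad-involutive : ∀ {x z} → Involutive x → z ∈ quad x → Involutive z
    quad-involutive xx z∈ with i , j , refl ← ∈-quad⁻ z∈ = involutive-∙ xx (v-involutive i j)

    ∑-quad : ∀ {x} → Involutive x → ∑ (quad x) ≡ ε
    ∑-quad {x} xx = begin
      x ∙ (x ∙ a ∙ (x ∙ b ∙ (x ∙ (a ∙ b) ∙ ε))) ≡⟨ cong (λ z → x ∙ (x ∙ a ∙ (x ∙ b ∙ z))) (identityʳ _) ⟩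
      x ∙ (x ∙ a ∙ (x ∙ b ∙ (x ∙ (a ∙ b))))     ≡⟨ cong (λ z → x ∙ (x ∙ a ∙ z)) (trans (interchange x b x (a ∙ b)) (trans (cong (_∙ (b ∙ (a ∙ b))) xx) (identityˡ _))) ⟩
      x ∙ (x ∙ a ∙ (b ∙ (a ∙ b)))               ≡⟨ cong (λ z → x ∙ (x ∙ a ∙ z)) (trans (x∙yz≈y∙xz b a b) (trans (cong (a ∙_) bb) (identityʳ a))) ⟩
      x ∙ (x ∙ a ∙ a)                           ≡⟨ cong (x ∙_) (trans (assoc x a a) (trans (cong (x ∙_) aa) (identityʳ x))) ⟩
      x ∙ x                                     ≡⟨ xx ⟩
      ε                                         ∎
      where open ≡-Reasoning

    involutions-closed : Quads.Closed involutions
    involutions-closed = record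
      { unique       = involutions-unique
      ; block-unique = λ {x} _ → quad-unique x
      ; block-⊆      = λ x∈ z∈ → ∈-involutions (quad-involutive (involutions⁻ x∈) z∈)
      }

    length-quads : ∀ qs → length (quads qs) ≡ length qs * 4
    length-quads []       = refl
    length-quads (_ ∷ qs) = cong (4 +_) (length-quads qs)

    ∑-quads : ∀ {qs} → All Involutive qs → ∑ (quads qs) ≡ ε
    ∑-quads []             = refl
    ∑-quads (_∷_ {x} {xs} p ps) = trans (∑-++ (quad x) (quads xs)) (trans (cong₂ _∙_ (∑-quad p) (∑-quads ps)) ε-involutive)

    zeroSum-skip : ∀ {i xs} ys → ZeroSum i xs → ZeroSum i (ys ++ xs)
    zeroSum-skip ys (zero-sum S R p l s) = zero-sum S (ys ++ R) (↭-trans (↭ₚ.shifts S ys) (↭ₚ.++⁺ˡ ys p)) l s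

    zeroSum-quads : ∀ {i xs qs} j → All Involutive qs → j ≤ length qs → ZeroSum i xs → ZeroSum (j * 4 + i) (quads qs ++ xs)
    zeroSum-quads {qs = qs} zero _ _ z = zeroSum-skip (quads qs) z
    zeroSum-quads {qs = q ∷ qs} (suc j) (qq ∷ invs) (s≤s h) z
      with zero-sum S R p l s ← zeroSum-quads j invs h z
      = zero-sum (quad q ++ S) R (↭ₚ.++⁺ˡ (quad q) p) (cong (4 +_) l)
          (trans (∑-++ (quad q) S) (trans (cong₂ _∙_ (∑-quad qq) s) ε-involutive))

    quads-involutive : ∀ {xs} qs → xs ↭ quads qs → All Involutive xs → All Involutive qs
    quads-involutive qs p inv = All.tabulate (λ {x} x∈ → All.lookup (↭ₚ.All-resp-↭ p inv) (mem qs x∈))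
      where
      mem : ∀ {x} qs → x ∈ qs → x ∈ quads qs
      mem (q ∷ qs) (here refl) = here refl
      mem (q ∷ qs) (there x∈)  = ∈-++⁺ʳ (quad q) (mem qs x∈)

    all-involutive : All Involutive involutions
    all-involutive = All.tabulate involutions⁻

    module Decomposed {R qs : List C} (perm : involutions ↭ quad ε ++ R) (closed : Quads.Closed R) (qs-perm : R ↭ quads qs) where

      perm-quads : involutions ↭ quads (ε ∷ qs)
      perm-quads = ↭-trans perm (↭ₚ.++⁺ˡ (quad ε) qs-perm)

      involutive-qs : All Involutive qs
      involutive-qs with _ ∷ inv ← quads-involutive (ε ∷ qs) perm-quads all-involutive = inv

      -- The coset of `ε` is kept apart, because it alone supplies the residues 1 and 3 modulo 4.
      perm-base : involutions ↭ quads qs ++ quad ε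
      perm-base = ↭-trans perm-quads (↭ₚ.++-comm (quad ε) (quads qs))

      K : ℕ
      K = suc (length qs) * 4

      length-involutions : length involutions ≡ K
      length-involutions = trans (↭ₚ.↭-length perm-quads) (length-quads (ε ∷ qs))

      zeroSum-1 : ZeroSum 1 (quad ε)
      zeroSum-1 = zero-sum (ε ∷ []) _ ↭-refl refl ε-involutive

      zeroSum-3 : ZeroSum 3 (quad ε)
      zeroSum-3 = zeroSum-complement (∑-quad ε-involutive) refl zeroSum-1

      zeroSum-0mod4 : ∀ j → j * 4 + 0 ≤ K → ZeroSum (j * 4 + 0) involutions
      zeroSum-0mod4 j h = zeroSum-↭ (↭-sym (↭-trans perm-quads (↭-reflexive (sym (++-identityʳ _)))))
        (zeroSum-quads j (ε-involutive ∷ involutive-qs)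
          (ℕₚ.*-cancelʳ-≤ j (suc (length qs)) 4 (ℕₚ.≤-trans (ℕₚ.m≤m+n _ 0) h))
          (zero-sum [] [] ↭-refl refl refl))

      zeroSum-base : ∀ {i} → ZeroSum (suc i) (quad ε) → ∀ j → j * 4 + suc i ≤ K → ZeroSum (j * 4 + suc i) involutions
      zeroSum-base {i} z j h = zeroSum-↭ (↭-sym perm-base) (zeroSum-quads j involutive-qs
        (ℕₚ.≤-pred (ℕₚ.*-cancelʳ-< 4 j (suc (length qs)) (ℕₚ.≤-trans (ℕₚ.≤-trans (ℕₚ.m≤m+n (suc (j * 4)) i) (ℕₚ.≤-reflexive (sym (ℕₚ.+-suc (j * 4) i)))) h))) z)

      balanced-involutions : ∀ {p m} i → ZeroSum i involutions → p + m ≡ i → Balanced p m involutions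
      balanced-involutions {p} {m} _ z refl = zeroSum⇒balanced p m all-involutive z

      small-balanced : ∀ p m → Quarter (p + m) → p + m ≤ K → Balanced p m involutions ⊎ (∃[ j ] p + m ≡ j * 4 + 2)
      small-balanced p m q h = go q refl h
        where
        go : ∀ {n} → Quarter n → p + m ≡ n → n ≤ K → Balanced p m involutions ⊎ (∃[ j ] p + m ≡ j * 4 + 2)
        go (rem0 j) eq h = inj₁ (balanced-involutions _ (zeroSum-0mod4 j h) eq)
        go (rem1 j) eq h = inj₁ (balanced-involutions _ (zeroSum-base zeroSum-1 j h) eq)
        go (rem2 j) eq h = inj₂ (j , eq)
        go (rem3 j) eq h = inj₁ (balanced-involutions _ (zeroSum-base zeroSum-3 j h) eq)

      -- One pair already repairs the residue 2 mod 4; further pairs only enlarge the range.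
      balanced-one-pair : ∀ x p m → p + m ≤ 2 + K → ¬ (p ≡ 1 × m ≡ 1) → Balanced p m (pair x ++ involutions)
      balanced-one-pair x p m h ¬11 with p + m ℕ.≤? K
      ... | yes h′ with small-balanced p m (quarter _) h′
      ...   | inj₁ b        = balanced-skip (pair x) b
      ...   | inj₂ (j , eq) = use-pair x p m (subst (2 ≤_) (sym eq) (ℕₚ.m≤n+m 2 (j * 4))) ¬11 λ p′ m′ eq′ →
          let eq″ = ℕₚ.+-cancelˡ-≡ 2 _ _ (trans eq′ (trans eq (trans (ℕₚ.+-comm (j * 4) 2) (cong (2 +_) (sym (ℕₚ.+-identityʳ (j * 4))))))) in
          balanced-involutions _ (zeroSum-0mod4 j (ℕₚ.≤-trans (ℕₚ.≤-reflexive (sym eq″)) (ℕₚ.≤-trans (ℕₚ.m≤n+m _ 2) (ℕₚ.≤-trans (ℕₚ.≤-reflexive eq′) h′)))) eq″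
      -- Here `p + m` is K + 1 or K + 2, so K - 1 or K places remain after the pair. As K is a
      -- multiple of 4, neither has residue 2.
      balanced-one-pair x p m h ¬11 | no h′ = use-pair x p m (ℕₚ.≤-trans (s≤s (s≤s z≤n)) (ℕₚ.≰⇒> h′)) ¬11 λ p′ m′ eq′ →
          [ (λ b → b) , (λ { (j , eq″) → contradiction (trans eq″ (ℕₚ.+-comm (j * 4) 2)) (residue j (ℕₚ.≤-pred (ℕₚ.≤-pred (subst (_≤ 2 + K) (sym eq′) h))) (ℕₚ.≤-pred (subst (suc K ≤_) (sym eq′) (ℕₚ.≰⇒> h′)))) }) ]′
            (small-balanced p′ m′ (quarter _) (ℕₚ.≤-pred (ℕₚ.≤-pred (subst (_≤ 2 + K) (sym eq′) h))))
        where
        residue : ∀ j {n} → n ≤ K → K ≤ suc n → n ≢ 2 + j * 4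
        residue j h₁ h₂ refl = ℕₚ.<-irrefl refl (ℕₚ.<-≤-trans j<s (ℕₚ.≤-pred s<j))
          where
          j<s : j < suc (length qs)
          j<s = ℕₚ.*-cancelʳ-< 4 j (suc (length qs)) (ℕₚ.≤-trans (ℕₚ.n≤1+n _) h₁)
          s<j : suc (length qs) < suc j
          s<j = ℕₚ.*-cancelʳ-< 4 (suc (length qs)) (suc j) (s≤s h₂)

      balanced-more-pairs : ∀ x ps p m → p + m ≤ length (x ∷ ps) * 2 + K → ¬ (p ≡ 1 × m ≡ 1) →
                            Balanced p m (pairs (x ∷ ps) ++ involutions)
      balanced-more-pairs x []       p m h ¬11 = balanced-one-pair x p m h ¬11
      balanced-more-pairs x (y ∷ ps) p m h ¬11 with p + m ℕ.≤? length (y ∷ ps) * 2 + K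
      ... | yes h′ = balanced-skip (pair x) (balanced-more-pairs y ps p m h′ ¬11)
      ... | no h′  = use-pair x p m (ℕₚ.≤-trans (s≤s (s≤s z≤n)) (ℕₚ.≰⇒> h′)) ¬11 λ p′ m′ eq →
          balanced-more-pairs y ps p′ m′ (ℕₚ.≤-pred (ℕₚ.≤-pred (ℕₚ.≤-trans (ℕₚ.≤-reflexive eq) h)))
            -- A remainder 1 + 1 would mean `p + m ≡ 4`, but four elements already fit without this
            -- pair, as K is at least 4.
            λ { (refl , refl) → h′ (ℕₚ.≤-trans (ℕₚ.≤-reflexive (sym eq)) (ℕₚ.≤-trans (ℕₚ.m≤m+n 4 (length qs * 4)) (ℕₚ.m≤n+m K (length (y ∷ ps) * 2)))) }

      module Elementary (all-involutions : involutions ↭ universe) where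

        k-eq : k ≡ K
        k-eq = trans (universe-length (↭-sym all-involutions)) length-involutions

        -- The cosets of 0, c, d and c + d form a subgroup of order 16. Order 8 is too small for six
        -- elements with sum 0: the other two would be different and also sum to 0.
        record Independent : Set where
          field
            c d    : C
            cd     : Involutive (c ∙ d)
            rs     : List C
            perm₁₆ : involutions ↭ quads rs ++ (quad (c ∙ d) ++ (quad d ++ (quad c ++ quad ε)))

        involutions-nonempty : ∀ {xs base} → involutions ↭ xs ++ base → length base < K → ∃[ x ] x ∈ xs
        involutions-nonempty p lt = nonempty (↭-trans (↭-sym all-involutions) p) (ℕₚ.<-≤-trans lt (ℕₚ.≤-reflexive (sym k-eq)))

        move-quad : ∀ {x xs ys base} → xs ↭ quad x ++ ys → involutions ↭ xs ++ base → involutions ↭ ys ++ (quad x ++ base)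
        move-quad {x} {ys = ys} {base} p q = ↭-trans q (↭-trans (↭ₚ.++⁺ʳ base p)
          (↭-trans (↭ₚ.++⁺ʳ base (↭ₚ.++-comm (quad x) ys)) (↭-reflexive (++-assoc ys (quad x) base))))

        cancel-coset : ∀ {x y} → x ∙ y ∈ quad x → y ∈ quad ε
        cancel-coset {x} {y} p with i , j , eq ← ∈-quad⁻ p =
          ∈-quad⁺ i j (trans (∙-cancelˡ x y (v i j) eq) (sym (identityˡ (v i j))))

        swap-ε : ∀ {x y} → Involutive x → x ∙ y ∈ quad ε → y ∈ quad x
        swap-ε {x} {y} xx p with i , j , eq ← ∈-quad⁻ p =
          ∈-quad⁺ i j (∙-cancelˡ x y (x ∙ v i j) (trans eq (trans (cong (_∙ v i j) (sym xx)) (assoc x x (v i j)))))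

        start : involutions ↭ R ++ quad ε
        start = ↭-trans perm (↭ₚ.++-comm (quad ε) R)

        involutive-R : ∀ {x} → x ∈ R → Involutive x
        involutive-R x∈ = involutions⁻ (↭ₚ.∈-resp-↭ (↭-sym start) (∈-++⁺ˡ x∈))

        R-disjoint : ∀ {x} → x ∈ R → x ∉ quad ε
        R-disjoint x∈ x∈ε = Unique-++-disjoint (quad ε) (Unique-resp-↭ perm involutions-unique) x∈ε x∈

        third-coset : ∀ {c d R₁ R₂} → c ∈ R → d ∈ R₁ → R ↭ quad c ++ R₁ → R₁ ↭ quad d ++ R₂ → Quads.Closed R₂ → Independent
        third-coset {c} {d} {R₁} {R₂} c∈ d∈₁ p₁ p₂ c₂ = finish (Quads.split-block c₂ cd∈)
          where
          d∈ : d ∈ R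
          d∈ = ↭ₚ.∈-resp-↭ (↭-sym p₁) (∈-++⁺ʳ (quad c) d∈₁)
          d∉c : d ∉ quad c
          d∉c d∈c = Unique-++-disjoint (quad c) (Unique-resp-↭ p₁ (Quads.Closed.unique closed)) d∈c d∈₁
          cd : Involutive (c ∙ d)
          cd = involutive-∙ (involutive-R c∈) (involutive-R d∈)
          cd∈ : c ∙ d ∈ R₂
          cd∈ = remaining-∈ p₂ (remaining-∈ p₁ (remaining-∈ perm (∈-involutions cd)
                  (d∉c ∘ swap-ε (involutive-R c∈)))
                  (R-disjoint d∈ ∘ cancel-coset))
                  (R-disjoint c∈ ∘ cancel-coset ∘ subst (_∈ quad d) (comm c d))
          finish : (∃[ R₃ ] (R₂ ↭ quad (c ∙ d) ++ R₃) × Quads.Closed R₃) → Independent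
          finish (R₃ , p₃ , c₃) with rs , q ← Quads.decompose c₃ = record
            { c = c ; d = d ; cd = cd ; rs = rs
            ; perm₁₆ = ↭-trans (move-quad p₃ (move-quad p₂ (move-quad p₁ start))) (↭ₚ.++⁺ʳ _ q) }

        second-coset : ∀ {c R₁} → 2 ≤ length qs → c ∈ R → R ↭ quad c ++ R₁ → Quads.Closed R₁ → Independent
        second-coset h c∈ p₁ c₁
          with d , d∈₁ ← involutions-nonempty (move-quad p₁ start) (ℕₚ.≤-trans (ℕₚ.m≤m+n 9 3) (ℕₚ.*-monoˡ-≤ 4 (s≤s h)))
          with R₂ , p₂ , c₂ ← Quads.split-block c₁ d∈₁
          = third-coset c∈ d∈₁ p₁ p₂ c₂

        -- Two cosets besides the subgroup are enough: the sum of their representatives lies in yet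
        -- another one.
        independent : 2 ≤ length qs → Independent
        independent h
          with c , c∈ ← involutions-nonempty start (ℕₚ.≤-trans (ℕₚ.m≤m+n 5 7) (ℕₚ.*-monoˡ-≤ 4 (s≤s h)))
          with R₁ , p₁ , c₁ ← Quads.split-block closed c∈
          = second-coset h c∈ p₁ c₁

        module _ (ind : Independent) where
          open Independent ind

          base : List C
          base = quad (c ∙ d) ++ (quad d ++ (quad c ++ quad ε))

          involutive-base : All Involutive (quads rs ++ base)
          involutive-base = ↭ₚ.All-resp-↭ perm₁₆ all-involutive

          involutive-rs : All Involutive rs
          involutive-rs = quads-involutive rs ↭-refl (Allₚ.++⁻ˡ (quads rs) involutive-base)

          -- {a , b , a + b , c , d , c + d}.
          zeroSum-6 : ZeroSum 6 base
          zeroSum-6 = zero-sum (c ∙ d ∷ d ∷ c ∷ T₀) (T (c ∙ d) ++ (T d ++ (T c ++ (ε ∷ []))))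
            (heads-↭ (T (c ∙ d)) (T d) (T c) T₀) refl ∑-eq
            where
            T : C → List C
            T x = x ∙ a ∷ x ∙ b ∷ x ∙ (a ∙ b) ∷ []
            T₀ : List C
            T₀ = T ε
            ∑-eq : c ∙ d ∙ (d ∙ (c ∙ ∑ T₀)) ≡ ε
            ∑-eq = begin
              c ∙ d ∙ (d ∙ (c ∙ ∑ T₀)) ≡⟨ cong (λ z → c ∙ d ∙ (d ∙ (c ∙ z))) (trans (sym (identityˡ _)) (∑-quad ε-involutive)) ⟩
              c ∙ d ∙ (d ∙ (c ∙ ε))    ≡⟨ cong (λ z → c ∙ d ∙ (d ∙ z)) (identityʳ c) ⟩
              c ∙ d ∙ (d ∙ c)          ≡⟨ cong (c ∙ d ∙_) (comm d c) ⟩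
              c ∙ d ∙ (c ∙ d)          ≡⟨ cd ⟩
              ε                        ∎
              where open ≡-Reasoning

          -- For the size K - 6, which `zeroSum-6` does not reach even with all cosets outside
          -- `base`: this complement together with all of them does. The next size of residue 2 is K
          -- - 2, the exceptional one.
          zeroSum-10 : ZeroSum 10 base
          zeroSum-10 = zeroSum-complement ∑-base refl zeroSum-6
            where
            ∑-base : ∑ base ≡ ε
            ∑-base = ∑-quads (quads-involutive (c ∙ d ∷ d ∷ c ∷ ε ∷ []) ↭-refl (Allₚ.++⁻ʳ (quads rs) involutive-base))

          K-eq : K ≡ (4 + length rs) * 4
          K-eq = trans (sym length-involutions) (trans (↭ₚ.↭-length perm₁₆)
            (trans (length-++ (quads rs)) (trans (cong (_+ 16) (length-quads rs)) (ℕₚ.+-comm (length rs * 4) 16))))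

          zeroSum-2mod4 : ∀ j → suc j * 4 + 2 < K → suc j * 4 + 4 ≢ K → ZeroSum (suc j * 4 + 2) involutions
          zeroSum-2mod4 j lt ne with j ℕ.≤? length rs
          ... | yes h = zeroSum-↭ (↭-sym perm₁₆) (subst (λ i → ZeroSum i (quads rs ++ base)) (ℕ-eq j) (zeroSum-quads j involutive-rs h zeroSum-6))
            where
            ℕ-eq : ∀ j → j * 4 + 6 ≡ suc j * 4 + 2
            ℕ-eq = solve 1 (λ j → j :* con 4 :+ con 6 := (con 1 :+ j) :* con 4 :+ con 2) refl
              where open +-*-Solver
          ... | no h = zeroSum-↭ (↭-sym perm₁₆) (subst (λ i → ZeroSum i (quads rs ++ base)) (trans (ℕ-eq (length rs)) (cong (λ j → suc j * 4 + 2) (sym j-eq)))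
                         (zeroSum-quads (length rs) involutive-rs ℕₚ.≤-refl zeroSum-10))
            where
            ℕ-eq : ∀ j → j * 4 + 10 ≡ suc (suc j) * 4 + 2
            ℕ-eq = solve 1 (λ j → j :* con 4 :+ con 10 := (con 2 :+ j) :* con 4 :+ con 2) refl
              where open +-*-Solver
            suc-j< : suc j < 4 + length rs
            suc-j< = ℕₚ.*-cancelʳ-< 4 (suc j) (4 + length rs)
              (ℕₚ.≤-<-trans (ℕₚ.m≤m+n (suc j * 4) 2) (ℕₚ.<-≤-trans lt (ℕₚ.≤-reflexive K-eq)))
            suc-j≢ : suc (suc j) ≢ 4 + length rs
            suc-j≢ eq = ne (trans (ℕₚ.+-comm (suc j * 4) 4) (trans (cong (_* 4) eq) (sym K-eq)))
            j-eq : j ≡ suc (length rs)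
            j-eq = ℕₚ.≤-antisym (ℕₚ.≤-pred (ℕₚ.≤-pred (ℕₚ.≤-pred (ℕₚ.≤∧≢⇒< suc-j< suc-j≢)))) (ℕₚ.≰⇒> h)

        balanced-elementary : ∀ p m → 3 ≤ p + m → p + m < k → 2 + (p + m) ≢ k → Balanced p m involutions
        balanced-elementary p m h lt ne
          with small-balanced p m (quarter _) (ℕₚ.≤-trans (ℕₚ.<⇒≤ lt) (ℕₚ.≤-reflexive k-eq))
        ... | inj₁ b            = b
        ... | inj₂ (zero , eq)  = contradiction (subst (3 ≤_) eq h) λ { (s≤s (s≤s ())) }
        ... | inj₂ (suc j , eq) = balanced-involutions _ (zeroSum-2mod4 (independent 2≤qs) j lt′ ne′) eq
          where
          lt′ : suc j * 4 + 2 < K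
          lt′ = subst (_< K) eq (ℕₚ.<-≤-trans lt (ℕₚ.≤-reflexive k-eq))
          ne′ : suc j * 4 + 4 ≢ K
          ne′ eq′ = ne (trans (cong (2 +_) eq) (trans (ℕₚ.+-comm 2 (suc j * 4 + 2)) (trans (ℕₚ.+-assoc (suc j * 4) 2 2) (trans eq′ (sym k-eq)))))
          -- The size is at least 6 and at most K - 6, so K is at least 12.
          2≤qs : 2 ≤ length qs
          2≤qs = ℕₚ.≤-trans (s≤s (s≤s z≤n)) (ℕₚ.≤-pred (ℕₚ.≤∧≢⇒<
            (ℕₚ.*-cancelʳ-< 4 (suc j) (suc (length qs)) (ℕₚ.≤-<-trans (ℕₚ.m≤m+n (suc j * 4) 2) lt′))
            (λ eq′ → ne′ (trans (ℕₚ.+-comm (suc j * 4) 4) (cong (_* 4) eq′)))))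

      classify : ∀ ps → noninvolutions ↭ pairs ps → ∀ p m → 3 ≤ p + m → p + m < k → Outcome p m
      classify (x ∷ ps) q p m h lt = success (balanced-↭ (↭-sym (universe-pairs ↭-refl (x ∷ ps) q))
        (balanced-more-pairs x ps p m (ℕₚ.≤-trans (ℕₚ.<⇒≤ lt) (ℕₚ.≤-reflexive k-eq)) λ { (refl , refl) → contradiction h λ { (s≤s (s≤s ())) } }))
        where
        k-eq : k ≡ length (x ∷ ps) * 2 + K
        k-eq = trans (universe-length (universe-pairs ↭-refl (x ∷ ps) q))
          (trans (length-++ (pairs (x ∷ ps))) (cong₂ _+_ (length-pairs (x ∷ ps)) length-involutions))
      classify [] q p m h lt = go (2 + (p + m) ℕ.≟ k)
        where
        all-involutions : universe ↭ involutions
        all-involutions = noninvolutions-empty q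
        go : Dec (2 + (p + m) ≡ k) → Outcome p m
        go (yes eq) = order-two (λ x → involutions⁻ (↭ₚ.∈-resp-↭ all-involutions (∈-allFin x))) eq
        go (no ne)  = success (balanced-↭ (↭-sym all-involutions) (Elementary.balanced-elementary (↭-sym all-involutions) p m h lt ne))

    classify-many : ∀ p m → 3 ≤ p + m → p + m < k → Outcome p m
    classify-many
      with R , perm , closed ← Quads.split-block involutions-closed (∈-involutions ε-involutive)
      with qs , qs-perm ← Quads.decompose closed
      with ps , q ← paired
      = Decomposed.classify {qs = qs} perm closed qs-perm ps q

    ∑-involutions : ∑ involutions ≡ ε
    ∑-involutions with qs , qs-perm ← Quads.decompose involutions-closed =
      trans (∑-↭ qs-perm) (∑-quads (quads-involutive qs qs-perm all-involutive))

  -- The classification, and the sum of all elements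

  classify-order-three : involutions ↭ ε ∷ [] → OrderThree → ∀ {p m} → BothOdd p m → 3 ≤ p + m → p + m < k → Outcome p m
  classify-order-three perm o3 (both-odd x y) h lt = go x y h lt
    where
    open NoInvolution perm
    5≤k : ∀ x → suc x * 2 + 1 + 1 < k → 5 ≤ k
    5≤k x lt = five-≤ x 0 (subst (λ p → p + 1 < k) (suc-odd x) lt)
    single : ∀ x → suc x * 2 + 1 + 1 < k → Outcome (suc x * 2 + 1) 1
    single x lt with 2 + (suc x * 2 + 1 + 1) ℕ.≤? k
    ... | yes h = success (subst (λ p → Balanced p 1 universe) (sym (suc-odd x))
                    (order-three-3-1 o3 (independent o3 (5≤k x lt)) x 0 (subst (λ p → 2 + (p + 1) ≤ k) (suc-odd x) h)))
    ... | no h  = order-three o3 (ℕₚ.≤-antisym lt (ℕₚ.≤-pred (ℕₚ.≰⇒> h)))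
                    (s≤s (s≤s (ℕₚ.≤-trans (ℕₚ.m≤n+m 2 (x * 2)) (ℕₚ.≤-reflexive (sym (ℕₚ.+-assoc (x * 2) 1 1)))))) (inj₂ refl)
    go : ∀ x y → 3 ≤ x * 2 + 1 + (y * 2 + 1) → x * 2 + 1 + (y * 2 + 1) < k → Outcome (x * 2 + 1) (y * 2 + 1)
    go zero    zero    (s≤s (s≤s ())) _
    go (suc x) zero    _ lt = single x lt
    go zero    (suc y) _ lt = outcome-swap (single y (subst (_< k) (ℕₚ.+-comm 1 (suc y * 2 + 1)) lt))
    go (suc x) (suc y) _ lt = success (subst (λ p → Balanced p (suc y * 2 + 1) universe) (sym (suc-odd x))
      (subst (λ m → Balanced (x * 2 + 3) m universe) (sym (suc-odd y))
        (order-three-3-3 o3 (independent o3 (5≤k x (ℕₚ.≤-<-trans (ℕₚ.+-monoʳ-≤ (suc x * 2 + 1) (ℕₚ.m≤n+m 1 (suc y * 2))) lt))) x y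
          (subst (λ p → p + (y * 2 + 3) < k) (suc-odd x) (subst (λ m → suc x * 2 + 1 + m < k) (suc-odd y) lt)))))

  classify-no-involution : involutions ↭ ε ∷ [] → ∀ {p m} → BothOdd p m → 3 ≤ p + m → p + m < k → Outcome p m
  classify-no-involution perm bo h lt with Finₚ.all? (λ x → x ∙ (x ∙ x) Fin.≟ ε)
  ... | yes o3 = classify-order-three perm o3 bo h lt
  ... | no ¬o3 with a , a³ ← Finₚ.¬∀⟶∃¬ k _ (λ x → x ∙ (x ∙ x) Fin.≟ ε) ¬o3 =
    success (both-odd-balanced (NoInvolution.balanced-3-1 perm a³) bo h lt)

  two-involutions : ∀ {a b xs} {T : Set} → involutions ↭ ε ∷ a ∷ b ∷ xs →
         (Involutive a → Involutive b → a ≢ ε → b ≢ ε → b ≢ a → T) → T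
  two-involutions perm f with (ε≢a ∷ ε≢b ∷ _) ∷ (a≢b ∷ _) ∷ _ ← Unique-resp-↭ perm involutions-unique = f
      (involutions⁻ (↭ₚ.∈-resp-↭ (↭-sym perm) (there (here refl))))
      (involutions⁻ (↭ₚ.∈-resp-↭ (↭-sym perm) (there (there (here refl)))))
      (ε≢a ∘ sym) (ε≢b ∘ sym) (a≢b ∘ sym)

  classify : ∀ p m → 3 ≤ p + m → p + m < k → Outcome p m
  classify p m h lt with ε-first
  ... | a ∷ b ∷ xs , perm = two-involutions perm (λ aa bb a≢ε b≢ε b≢a → ManyInvolutions.classify-many aa bb a≢ε b≢ε b≢a p m h lt)
  ... | []         , perm = [ success , (λ bo → classify-no-involution perm bo h lt) ]′ (few-involutions perm z≤n p m lt)
  ... | ι ∷ []     , perm = success ([ (λ b → b) , (λ bo → both-odd-balanced (OneInvolution.balanced-3-1 perm) bo h lt) ]′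
                                       (few-involutions perm (s≤s z≤n) p m lt))

  all-involutions : OrderTwo → universe ↭ involutions
  all-involutions o2 = noninvolutions-empty (↭-reflexive (empty noninvolutions λ x∈ → noninvolutions⁻ x∈ (o2 _)))
    where
    empty : (xs : List C) → (∀ {x} → x ∉ xs) → xs ≡ []
    empty []       _  = refl
    empty (x ∷ xs) ∉ = contradiction (here refl) ∉

  -- A Klein four-group is needed to cut the group into zero-sum cosets; in the group of order two
  -- the sum is the non-zero element.
  ∑-universe-order-two : OrderTwo → 3 ≤ k → ∑ universe ≡ ε
  ∑-universe-order-two o2 3≤k with ε-first
  ... | []         , perm = contradiction 3≤k (ℕₚ.<⇒≱ (s≤s (ℕₚ.≤-trans (ℕₚ.≤-reflexive (universe-length (↭-trans (all-involutions o2) perm))) (ℕₚ.n≤1+n 1))))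
  ... | ι ∷ []     , perm = contradiction 3≤k (ℕₚ.<⇒≱ (s≤s (ℕₚ.≤-reflexive (universe-length (↭-trans (all-involutions o2) perm)))))
  ... | a ∷ b ∷ xs , perm =
    trans (∑-↭ (all-involutions o2)) (two-involutions perm (λ aa bb a≢ε b≢ε b≢a → ManyInvolutions.∑-involutions aa bb a≢ε b≢ε b≢a))

  -- Inverse pairs cancel, and 2x = 0 together with 3x = 0 leaves only `ε` unpaired.
  ∑-universe-order-three : OrderThree → ∑ universe ≡ ε
  ∑-universe-order-three o3
    with xs , perm ← ε-first
    with ps , q ← paired
    = trans (∑-↭ (universe-pairs (↭-trans perm (prep ε (↭-reflexive (empty (Unique-resp-↭ perm involutions-unique) λ x∈ →
        involutive⇒ε (involutions⁻ (↭ₚ.∈-resp-↭ (↭-sym perm) (there x∈))))))) ps q))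
        (trans (∑-++ (pairs ps) (ε ∷ [])) (trans (cong₂ _∙_ (∑-pairs ps) ε-involutive) ε-involutive))
    where
    involutive⇒ε : ∀ {x} → Involutive x → x ≡ ε
    involutive⇒ε {x} xx = trans (sym (identityʳ x)) (trans (cong (x ∙_) (sym xx)) (o3 x))
    empty : ∀ {xs} → Unique (ε ∷ xs) → (∀ {x} → x ∈ xs → x ≡ ε) → xs ≡ []
    empty {[]}     _ _ = refl
    empty {x ∷ xs} u f = contradiction (here (sym (f (here refl)))) (Uniqueₚ.Unique[x∷xs]⇒x∉xs u)

  -- Coordinates on elementary Abelian groups

  module ElementaryAbelian (p : ℕ) .{{p≢0 : NonZero p}} (2≤p : 2 ≤ p) where
    open CommutativeMonoidMult commutativeMonoid using () renaming (_×_ to _·_; ×-homo-+ to ·-homo-+; ×-assocˡ to ·-assocˡ)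

    -- `invertible` stands in for the primality of `p`: non-zero multipliers can be undone, as in a
    -- vector space over the field with `p` elements.
    module _ (exponent : ∀ x → p · x ≡ ε)
             (invertible : ∀ d → 0 < d → d < p → ∃[ e ] (∀ x → e · (d · x) ≡ x)) where

      ·-ε : ∀ n → n · ε ≡ ε
      ·-ε zero    = refl
      ·-ε (suc n) = trans (identityˡ _) (·-ε n)

      ·-% : ∀ n x → (n % p) · x ≡ n · x
      ·-% n x = sym (begin
        n · x                                ≡⟨ cong (_· x) (m≡m%n+[m/n]*n n p) ⟩
        (n % p + n / p * p) · x              ≡⟨ ·-homo-+ x (n % p) (n / p * p) ⟩
        (n % p) · x ∙ (n / p * p) · x        ≡⟨ cong ((n % p) · x ∙_) (·-assocˡ x (n / p) p) ⟨
        (n % p) · x ∙ (n / p) · (p · x)      ≡⟨ cong (λ z → (n % p) · x ∙ (n / p) · z) (exponent x) ⟩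
        (n % p) · x ∙ (n / p) · ε            ≡⟨ cong ((n % p) · x ∙_) (·-ε (n / p)) ⟩
        (n % p) · x ∙ ε                      ≡⟨ identityʳ _ ⟩
        (n % p) · x                          ∎)
        where open ≡-Reasoning

      ·-addMod : ∀ c d x → toℕ (addMod p c d) · x ≡ toℕ c · x ∙ toℕ d · x
      ·-addMod c d x = trans (cong (_· x) (Finₚ.toℕ-fromℕ< (m%n<n (toℕ c + toℕ d) p)))
                             (trans (·-% (toℕ c + toℕ d) x) (·-homo-+ x (toℕ c) (toℕ d)))

      lin : ∀ {q} → Vec C q → Vec (Fin p) q → C
      lin []       []       = ε
      lin (b ∷ bs) (c ∷ cs) = toℕ c · b ∙ lin bs cs

      lin-∙ : ∀ {q} (bs : Vec C q) cs ds → lin bs (zipWith (addMod p) cs ds) ≡ lin bs cs ∙ lin bs ds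
      lin-∙ []       []       []       = sym ε-involutive
      lin-∙ (b ∷ bs) (c ∷ cs) (d ∷ ds) =
        trans (cong₂ _∙_ (·-addMod c d b) (lin-∙ bs cs ds)) (interchange (toℕ c · b) (toℕ d · b) (lin bs cs) (lin bs ds))

      Span : ∀ {q} → Vec C q → C → Set
      Span bs x = ∃[ cs ] lin bs cs ≡ x

      span-∙ : ∀ {q} (bs : Vec C q) {x y} → Span bs x → Span bs y → Span bs (x ∙ y)
      span-∙ bs (cs , refl) (ds , refl) = zipWith (addMod p) cs ds , lin-∙ bs cs ds

      span-ε : ∀ {q} (bs : Vec C q) → Span bs ε
      span-ε []       = [] , refl
      span-ε (b ∷ bs) with cs , eq ← span-ε bs = fromℕ< 0<p ∷ cs ,
        trans (cong₂ (λ n x → n · b ∙ x) (Finₚ.toℕ-fromℕ< 0<p) eq) ε-involutive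
        where
        0<p : 0 < p
        0<p = ℕₚ.<-≤-trans (s≤s z≤n) 2≤p

      span-· : ∀ {q} (bs : Vec C q) n {x} → Span bs x → Span bs (n · x)
      span-· bs zero    s = span-ε bs
      span-· bs (suc n) s = span-∙ bs s (span-· bs n s)

      span-⁻¹ : ∀ {q} (bs : Vec C q) {x} → Span bs x → Span bs (x ⁻¹)
      span-⁻¹ bs {x} s = subst (Span bs)
        (inverseʳ-unique x (ℕ.pred p · x) (trans (cong (_· x) (ℕₚ.suc-pred p)) (exponent x))) (span-· bs (ℕ.pred p) s)

      Injective-lin : ∀ {q} → Vec C q → Set
      Injective-lin bs = ∀ cs ds → lin bs cs ≡ lin bs ds → cs ≡ ds

      -- Unequal coefficients of `y` leave a non-zero multiple of `y` in the span, and `invertible`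
      -- recovers `y` from it.
      span-difference : ∀ {q} (bs : Vec C q) {y} m n cs ds → m < n → n < p →
                        m · y ∙ lin bs cs ≡ n · y ∙ lin bs ds → Span bs y
      span-difference bs {y} m n cs ds m<n n<p eq
        with e , inv ← invertible (n ∸ m) (ℕₚ.m<n⇒0<n∸m m<n) (ℕₚ.≤-<-trans (ℕₚ.m∸n≤m n m) n<p)
        = subst (Span bs) (inv y) (span-· bs e (subst (Span bs) dy (span-∙ bs (cs , refl) (span-⁻¹ bs (ds , refl)))))
        where
        split : lin bs cs ≡ (n ∸ m) · y ∙ lin bs ds
        split = ∙-cancelˡ (m · y) _ _ (begin
          m · y ∙ lin bs cs                   ≡⟨ eq ⟩
          n · y ∙ lin bs ds                   ≡⟨ cong (λ n → n · y ∙ lin bs ds) (ℕₚ.m+[n∸m]≡n (ℕₚ.<⇒≤ m<n)) ⟨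
          (m + (n ∸ m)) · y ∙ lin bs ds       ≡⟨ cong (_∙ lin bs ds) (·-homo-+ y m (n ∸ m)) ⟩
          m · y ∙ (n ∸ m) · y ∙ lin bs ds     ≡⟨ assoc _ _ _ ⟩
          m · y ∙ ((n ∸ m) · y ∙ lin bs ds)   ∎)
          where open ≡-Reasoning
        dy : lin bs cs ∙ lin bs ds ⁻¹ ≡ (n ∸ m) · y
        dy = trans (cong (_∙ lin bs ds ⁻¹) split) (trans (assoc _ _ _) (trans (cong ((n ∸ m) · y ∙_) (inverseʳ _)) (identityʳ _)))

      extend : ∀ {q} {bs : Vec C q} {y} → Injective-lin bs → ¬ Span bs y → Injective-lin (y ∷ bs)
      extend {bs = bs} {y} inj y∉ (c ∷ cs) (d ∷ ds) eq with ℕₚ.<-cmp (toℕ c) (toℕ d)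
      ... | tri< c<d _ _ = contradiction (span-difference bs (toℕ c) (toℕ d) cs ds c<d (Finₚ.toℕ<n d) eq) y∉
      ... | tri> _ _ d<c = contradiction (span-difference bs (toℕ d) (toℕ c) ds cs d<c (Finₚ.toℕ<n c) (sym eq)) y∉
      ... | tri≈ _ c≡d _ with refl ← Finₚ.toℕ-injective c≡d = cong (c ∷_) (inj cs ds (∙-cancelˡ (toℕ c · y) _ _ eq))

      span? : ∀ {q} (bs : Vec C q) x → Dec (Span bs x)
      span? bs x with Finₚ.any? (λ i → lin bs (decode p i) Fin.≟ x)
      ... | yes (i , eq) = yes (decode p i , eq)
      ... | no ¬i        = no λ { (cs , eq) → ¬i (encode p cs , trans (cong (lin bs) (decode-encode p cs)) eq) }

      record Coordinates : Set where
        field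
          q           : ℕ
          basis       : Vec C q
          injective   : Injective-lin basis
          surjective  : ∀ x → Span basis x

      -- A greedy basis: as long as some element lies outside the span, it is adjoined. Independence
      -- gives `p ^ q` different elements, so q < p ^ q ≤ k and the fuel cannot run out.
      search : ∀ fuel {q} (bs : Vec C q) → q + fuel ≡ k → Injective-lin bs → Coordinates
      search fuel {q} bs eq inj with Finₚ.all? (span? bs)
      ... | yes surj = record { basis = bs ; injective = inj ; surjective = surj }
      search zero {q} bs eq inj | no ¬surj = contradiction
        (Finₚ.injective⇒≤ {f = λ i → lin bs (decode p i)} λ {i} {j} e →
          trans (sym (encode-decode p q i)) (trans (cong (encode p) (inj _ _ e)) (encode-decode p q j)))
        (ℕₚ.<⇒≱ (subst (_< p ℕ.^ q) (trans (sym (ℕₚ.+-identityʳ q)) eq) (n<p^n 2≤p q)))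
      search (suc fuel) {q} bs eq inj | no ¬surj with y , y∉ ← Finₚ.¬∀⟶∃¬ k _ (span? bs) ¬surj =
        search fuel (y ∷ bs) (trans (sym (ℕₚ.+-suc q fuel)) eq) (extend inj y∉)

      coordinates : Coordinates
      coordinates = search k [] refl λ { [] [] _ → refl }

      elementary-isomorphism : ∃[ q ] p ℕ.^ q ≡ k × group ≅Zpow p ^ q
      elementary-isomorphism = q , Permutation.↔⇒≡ (mk↔ₛ′ (λ i → lin basis (decode p i)) (encode p ∘ coord)
          (λ x → trans (cong (lin basis) (decode-encode p _)) (proj₂ (surjective x)))
          (λ i → trans (cong (encode p) (coord-lin _)) (encode-decode p q i)))
        , record { to = coord ; from = lin basis ; to-cong = cong coord ; from-cong = cong (lin basis)
                 ; inverse = (λ { refl → coord-lin _ }) , (λ { refl → proj₂ (surjective _) }) }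
        , λ x y → injective _ _ (trans (proj₂ (surjective (x ∙ y)))
            (trans (sym (cong₂ _∙_ (proj₂ (surjective x)) (proj₂ (surjective y)))) (sym (lin-∙ basis _ _))))
        where
        open Coordinates coordinates
        coord : C → Vec (Fin p) q
        coord x = proj₁ (surjective x)
        coord-lin : ∀ cs → coord (lin basis cs) ≡ cs
        coord-lin cs = injective _ _ (proj₂ (surjective (lin basis cs)))

  open CommutativeMonoidMult commutativeMonoid using () renaming (_×_ to _·_)

  order-two⇒elementary : OrderTwo → ∃[ q ] 2 ℕ.^ q ≡ k × group ≅Zpow 2 ^ q
  order-two⇒elementary o2 = ElementaryAbelian.elementary-isomorphism 2 ℕₚ.≤-refl (λ x → trans (cong (x ∙_) (identityʳ x)) (o2 x)) inv
    where
    inv : ∀ d → 0 < d → d < 2 → ∃[ e ] (∀ x → e · (d · x) ≡ x)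
    inv 1 _ _ = 1 , λ x → trans (identityʳ _) (identityʳ x)
    inv (suc (suc d)) _ (s≤s (s≤s ()))

  order-three⇒elementary : OrderThree → ∃[ q ] 3 ℕ.^ q ≡ k × group ≅Zpow 3 ^ q
  order-three⇒elementary o3 = ElementaryAbelian.elementary-isomorphism 3 (s≤s (s≤s z≤n)) (λ x → trans (cong (λ z → x ∙ (x ∙ z)) (identityʳ x)) (o3 x)) inv
    where
    inv : ∀ d → 0 < d → d < 3 → ∃[ e ] (∀ x → e · (d · x) ≡ x)
    inv 1 _ _ = 1 , λ x → trans (identityʳ _) (identityʳ x)
    inv 2 _ _ = 2 , λ x → begin
      2 · (2 · x)             ≡⟨ cong₂ (λ y z → y ∙ z) refl (identityʳ _) ⟩
      2 · x ∙ 2 · x           ≡⟨ cong (λ z → z ∙ z) (cong (x ∙_) (identityʳ x)) ⟩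
      x ∙ x ∙ (x ∙ x)         ≡⟨ assoc x x (x ∙ x) ⟩
      x ∙ (x ∙ (x ∙ x))       ≡⟨ cong (x ∙_) (o3 x) ⟩
      x ∙ ε                   ≡⟨ identityʳ x ⟩
      x                       ∎
      where open ≡-Reasoning
    inv (suc (suc (suc d))) _ (s≤s (s≤s (s≤s ())))

  -- Realising weight functions by labellings

  Σᶠ : ∀ {n} → (Fin n → C) → C
  Σᶠ = ΣFin group

  Σ-cong : ∀ {n} {f g : Fin n → C} → (∀ i → f i ≡ g i) → Σᶠ f ≡ Σᶠ g
  Σ-cong {zero}  _ = refl
  Σ-cong {suc n} h = cong₂ _∙_ (h Fin.zero) (Σ-cong (h ∘ Fin.suc))

  Σ-ε : ∀ n → Σᶠ {n} (λ _ → ε) ≡ ε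
  Σ-ε zero    = refl
  Σ-ε (suc n) = trans (identityˡ _) (Σ-ε n)

  Σ-∙ : ∀ {n} (f g : Fin n → C) → Σᶠ (λ i → f i ∙ g i) ≡ Σᶠ f ∙ Σᶠ g
  Σ-∙ {zero}  f g = sym ε-involutive
  Σ-∙ {suc n} f g = trans (cong (f Fin.zero ∙ g Fin.zero ∙_) (Σ-∙ (f ∘ Fin.suc) (g ∘ Fin.suc)))
                          (interchange (f Fin.zero) (g Fin.zero) (Σᶠ (f ∘ Fin.suc)) (Σᶠ (g ∘ Fin.suc)))

  ∑-tabulate : ∀ {n} (f : Fin n → C) → ∑ (tabulate f) ≡ Σᶠ f
  ∑-tabulate {zero}  f = refl
  ∑-tabulate {suc n} f = cong (f Fin.zero ∙_) (∑-tabulate (f ∘ Fin.suc))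

  δ : ∀ {n} → Fin n → Fin n → C → C
  δ u x a = if does (x Fin.≟ u) then a else ε

  δ-≡ : ∀ {n} (u : Fin n) a → δ u u a ≡ a
  δ-≡ u a = cong (λ b → if b then a else ε) (dec-true (u Fin.≟ u) refl)

  δ-≢ : ∀ {n} {u x : Fin n} → x ≢ u → ∀ a → δ u x a ≡ ε
  δ-≢ {u = u} {x} x≢u a = cong (λ b → if b then a else ε) (dec-false (x Fin.≟ u) x≢u)

  δ-ε : ∀ {n} (u x : Fin n) → δ u x ε ≡ ε
  δ-ε u x with does (x Fin.≟ u)
  ... | true  = refl
  ... | false = refl

  δ-∙ : ∀ {n} (u x : Fin n) a b → δ u x (a ∙ b) ≡ δ u x a ∙ δ u x b
  δ-∙ u x a b with does (x Fin.≟ u)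
  ... | true  = refl
  ... | false = sym ε-involutive

  δ-sym : ∀ {n} (u x : Fin n) a → δ u x a ≡ δ x u a
  δ-sym u x a = by (x Fin.≟ u)
    where
    by : Dec (x ≡ u) → δ u x a ≡ δ x u a
    by (yes refl) = refl
    by (no x≢u)   = trans (δ-≢ x≢u a) (sym (δ-≢ (x≢u ∘ sym) a))

  Σ-δ : ∀ {n} (u : Fin n) (f : Fin n → C) → Σᶠ (λ x → δ u x (f x)) ≡ f u
  Σ-δ {suc n} Fin.zero    f = trans (cong (f Fin.zero ∙_) (Σ-ε n)) (identityʳ _)
  Σ-δ {suc n} (Fin.suc u) f = trans (identityˡ _) (Σ-δ u (f ∘ Fin.suc))

  Σ-δ-const : ∀ {n m} (u x : Fin n) (f : Fin m → C) → Σᶠ (λ i → δ u x (f i)) ≡ δ u x (Σᶠ f)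
  Σ-δ-const {m = zero}  u x f = sym (δ-ε u x)
  Σ-δ-const {m = suc m} u x f = trans (cong (δ u x (f Fin.zero) ∙_) (Σ-δ-const u x (f ∘ Fin.suc))) (sym (δ-∙ u x _ _))

  signed : Bool → C → C
  signed s a = if s then a else a ⁻¹

  signed-⁻¹ : ∀ s a → signed s (a ⁻¹) ≡ signed (not s) a
  signed-⁻¹ true  a = refl
  signed-⁻¹ false a = ⁻¹-involutive a

  if-∙ : ∀ b (x y : C) → (if b then x ∙ y else ε) ≡ (if b then x else ε) ∙ (if b then y else ε)
  if-∙ true  x y = refl
  if-∙ false x y = sym ε-involutive

  if-ε : ∀ b → (if b then ε else ε) ≡ ε
  if-ε true  = refl
  if-ε false = refl

  module _ {n : ℕ} (G : Graph n) where

    Realizable : (Fin n → C) → Set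
    Realizable w = Σ (Labelling group G) λ f → ∀ x → wdeg group f x ≡ w x

    realizable-cong : ∀ {w w′} → (∀ x → w x ≡ w′ x) → Realizable w → Realizable w′
    realizable-cong h (f , e) = f , λ x → trans (e x) (h x)

    realizable-ε : Realizable (λ _ → ε)
    realizable-ε = record { lab = λ _ _ → ε ; symm = λ _ _ → refl } ,
      λ x → trans (Σ-cong (λ y → if-ε (Adj G x y))) (Σ-ε n)

    realizable-∙ : ∀ {w w′} → Realizable w → Realizable w′ → Realizable (λ x → w x ∙ w′ x)
    realizable-∙ (f , e) (f′ , e′) =
      record { lab  = λ x y → Labelling.lab f x y ∙ Labelling.lab f′ x y
             ; symm = λ x y → cong₂ _∙_ (Labelling.symm f x y) (Labelling.symm f′ x y) } ,
      λ x → trans (Σ-cong (λ y → if-∙ (Adj G x y) _ _)) (trans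
        (Σ-∙ (λ y → if Adj G x y then Labelling.lab f x y else ε) (λ y → if Adj G x y then Labelling.lab f′ x y else ε))
        (cong₂ _∙_ (e x) (e′ x)))

    realizable-Σ : ∀ {m} (w : Fin m → Fin n → C) → (∀ i → Realizable (w i)) → Realizable (λ x → Σᶠ (λ i → w i x))
    realizable-Σ {zero}  w h = realizable-ε
    realizable-Σ {suc m} w h = realizable-∙ (h Fin.zero) (realizable-Σ (w ∘ Fin.suc) (h ∘ Fin.suc))

    -- A label on the single edge `uv` is split into its entries at `(u , v)` and `(v , u)`. Each is
    -- seen from one end only, so each accounts for the weight of that end.
    half-edge : ∀ {u v} → Adj G u v ≡ true → ∀ a x → Σᶠ (λ y → if Adj G x y then δ u x (δ v y a) else ε) ≡ δ u x a
    half-edge {u} {v} uv a x = by (x Fin.≟ u)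
      where
      by : Dec (x ≡ u) → Σᶠ (λ y → if Adj G x y then δ u x (δ v y a) else ε) ≡ δ u x a
      by (no x≢u) = trans (Σ-cong λ y → trans (cong (λ z → if Adj G x y then z else ε) (δ-≢ x≢u _)) (if-ε (Adj G x y)))
                          (trans (Σ-ε n) (sym (δ-≢ x≢u a)))
      by (yes refl) = trans (Σ-cong λ y → trans (cong (λ z → if Adj G u y then z else ε) (δ-≡ u _)) (at y (y Fin.≟ v)))
                            (trans (Σ-δ v (λ _ → a)) (sym (δ-≡ u a)))
        where
        at : ∀ y → Dec (y ≡ v) → (if Adj G u y then δ v y a else ε) ≡ δ v y a
        at y (yes refl) = cong (λ b → if b then δ v y a else ε) uv
        at y (no y≢v)   = trans (cong (λ z → if Adj G u y then z else ε) (δ-≢ y≢v a)) (trans (if-ε (Adj G u y)) (sym (δ-≢ y≢v a)))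

    realizable-edge : ∀ {u v} → Adj G u v ≡ true → ∀ a → Realizable (λ x → δ u x a ∙ δ v x a)
    realizable-edge {u} {v} uv a =
      record { lab  = λ x y → δ u x (δ v y a) ∙ δ v x (δ u y a)
             ; symm = λ x y → trans (comm _ _) (cong₂ _∙_ (δδ v x u y) (δδ u x v y)) } ,
      λ x → trans (Σ-cong (λ y → if-∙ (Adj G x y) _ _)) (trans
              (Σ-∙ (λ y → if Adj G x y then δ u x (δ v y a) else ε) (λ y → if Adj G x y then δ v x (δ u y a) else ε))
              (cong₂ _∙_ (half-edge uv a x) (half-edge (trans (Adj-sym G v u) uv) a x)))
      where
      δδ : ∀ u x v y → δ u x (δ v y a) ≡ δ v y (δ u x a)
      δδ u x v y with does (x Fin.≟ u) | does (y Fin.≟ v)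
      ... | true  | true  = refl
      ... | true  | false = refl
      ... | false | true  = refl
      ... | false | false = refl

    -- Alternating labels a, - a, a, … along a walk change only the weights of its two ends.
    realizable-walk : ∀ {v r} (W : Reach G v r) a → Realizable (λ x → δ v x a ∙ δ r x (signed (sign W) a))
    realizable-walk {v} here a = realizable-cong (λ x → sym (trans (sym (δ-∙ v x a (a ⁻¹))) (trans (cong (δ v x) (inverseʳ a)) (δ-ε v x)))) realizable-ε
    realizable-walk {u} {r} (step {v = v} uv W) a =
      realizable-cong eq (realizable-∙ (realizable-edge uv a) (realizable-walk W (a ⁻¹)))
      where
      open ≡-Reasoning
      eq : ∀ x → δ u x a ∙ δ v x a ∙ (δ v x (a ⁻¹) ∙ δ r x (signed (sign W) (a ⁻¹))) ≡ δ u x a ∙ δ r x (signed (not (sign W)) a)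
      eq x = begin
        δ u x a ∙ δ v x a ∙ (δ v x (a ⁻¹) ∙ δ r x (signed (sign W) (a ⁻¹)))   ≡⟨ assoc _ _ _ ⟩
        δ u x a ∙ (δ v x a ∙ (δ v x (a ⁻¹) ∙ δ r x (signed (sign W) (a ⁻¹)))) ≡⟨ cong (δ u x a ∙_) (assoc _ _ _) ⟨
        δ u x a ∙ (δ v x a ∙ δ v x (a ⁻¹) ∙ δ r x (signed (sign W) (a ⁻¹)))   ≡⟨ cong (λ z → δ u x a ∙ (z ∙ δ r x (signed (sign W) (a ⁻¹)))) (trans (sym (δ-∙ v x a (a ⁻¹))) (trans (cong (δ v x) (inverseʳ a)) (δ-ε v x))) ⟩
        δ u x a ∙ (ε ∙ δ r x (signed (sign W) (a ⁻¹)))                        ≡⟨ cong (δ u x a ∙_) (identityˡ _) ⟩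
        δ u x a ∙ δ r x (signed (sign W) (a ⁻¹))                              ≡⟨ cong (λ z → δ u x a ∙ δ r x z) (signed-⁻¹ (sign W) a) ⟩
        δ u x a ∙ δ r x (signed (not (sign W)) a)                             ∎

    -- Superposition: the walk from `v` delivers `w v` at `v`, and all side effects collect at the
    -- common root, where their total is the signed sum assumed to vanish.
    realize : ∀ {r} (walk : ∀ v → Reach G v r) (w : Fin n → C) →
              Σᶠ (λ v → signed (sign (walk v)) (w v)) ≡ ε → Realizable w
    realize {r} walk w h = realizable-cong eq (realizable-Σ _ (λ v → realizable-walk (walk v) (w v)))
      where
      eq : ∀ x → Σᶠ (λ v → δ v x (w v) ∙ δ r x (signed (sign (walk v)) (w v))) ≡ w x
      eq x = begin
        Σᶠ (λ v → δ v x (w v) ∙ δ r x (signed (sign (walk v)) (w v)))            ≡⟨ Σ-∙ (λ v → δ v x (w v)) (λ v → δ r x (signed (sign (walk v)) (w v))) ⟩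
        Σᶠ (λ v → δ v x (w v)) ∙ Σᶠ (λ v → δ r x (signed (sign (walk v)) (w v))) ≡⟨ cong₂ _∙_ (Σ-cong λ v → δ-sym v x (w v)) (Σ-δ-const r x (λ v → signed (sign (walk v)) (w v))) ⟩
        Σᶠ (λ v → δ x v (w v)) ∙ δ r x (Σᶠ (λ v → signed (sign (walk v)) (w v))) ≡⟨ cong₂ _∙_ (Σ-δ x w) (trans (cong (δ r x) h) (δ-ε r x)) ⟩
        w x ∙ ε                                                                  ≡⟨ identityʳ _ ⟩
        w x                                                                      ∎
        where open ≡-Reasoning

  distribute : ∀ {n} (σ : Fin n → Bool) P N → length P ≡ count σ → length N ≡ count (not ∘ σ) →
               Σ (Fin n → C) λ w → (tabulate w ↭ P ++ N) × (Σᶠ (λ v → signed (σ v) (w v)) ≡ ∑ P ∙ ∑ N ⁻¹)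
  distribute {zero}  σ []      []      _  _  = (λ ()) , ↭-refl , sym (inverseʳ ε)
  distribute {suc n} σ P       N       lP lN with σ Fin.zero
  distribute {suc n} σ (x ∷ P) N       lP lN | true
    with w , perm , eq ← distribute (σ ∘ Fin.suc) P N (ℕₚ.suc-injective lP) lN
    = (λ { Fin.zero → x ; (Fin.suc v) → w v }) , prep x perm , trans (cong (x ∙_) eq) (sym (assoc _ _ _))
  distribute {suc n} σ P       (x ∷ N) lP lN | false
    with w , perm , eq ← distribute (σ ∘ Fin.suc) P N lP (ℕₚ.suc-injective lN)
    = (λ { Fin.zero → x ; (Fin.suc v) → w v }) , ∷↭++∷ P perm
    , trans (cong (x ⁻¹ ∙_) eq) (trans (x∙yz≈y∙xz _ _ _) (cong (∑ P ∙_) (⁻¹-∙-comm x (∑ N))))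

  balanced⇒admits : ∀ {n} (G : Graph n) {r} (walk : ∀ v → Reach G v r) →
                    Balanced (count (sign ∘ walk)) (count (not ∘ sign ∘ walk)) universe → Admits G group
  balanced⇒admits G walk (balanced P N R perm lP lN ∑-eq)
    with w , w-perm , w-∑ ← distribute (sign ∘ walk) P N lP lN
    with f , f-w ← realize G walk w (trans w-∑ (trans (cong (λ z → ∑ P ∙ z ⁻¹) (sym ∑-eq)) (inverseʳ (∑ P))))
    = f , λ u v eq → Unique-tabulate⁻ w (Unique-resp-↭ (↭-sym w-perm) unique) u v (trans (sym (f-w u)) (trans eq (f-w v)))
    where
    unique : Unique (P ++ N)
    unique = Unique-++⁻ˡ (P ++ N) (subst Unique (sym (++-assoc P N R)) (Unique-resp-↭ (↭-sym perm) (Uniqueₚ.allFin⁺ k)))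

  -- Sums of weights, and why the exceptions admit no labelling

  module _ {n : ℕ} (G : Graph n) (f : Labelling group G) where
    open Labelling f

    entry : Fin n → Fin n → C
    entry u v = if Adj G u v then lab u v else ε

    entry-sym : ∀ u v → entry u v ≡ entry v u
    entry-sym u v = cong₂ (λ b x → if b then x else ε) (Adj-sym G u v) (symm u v)

    entry-diagonal : ∀ v → entry v v ≡ ε
    entry-diagonal v = cong (λ b → if b then lab v v else ε) (irrefl G v)

    -- The weight of a leaf is the label of its spoke, so the leaves together contribute the weight
    -- of the centre once more.
    star-∑ : ∀ {c} → IsStar G c → Σᶠ (wdeg group f) ≡ wdeg group f c ∙ wdeg group f c
    star-∑ {c} star = begin
      Σᶠ (wdeg group f)                                            ≡⟨ Σ-cong (λ v → weight v (v Fin.≟ c)) ⟩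
      Σᶠ (λ v → δ c v (wdeg group f c) ∙ entry c v)                ≡⟨ Σ-∙ (λ v → δ c v (wdeg group f c)) (entry c) ⟩
      Σᶠ (λ v → δ c v (wdeg group f c)) ∙ wdeg group f c           ≡⟨ cong (_∙ wdeg group f c) (Σ-δ c (λ _ → wdeg group f c)) ⟩
      wdeg group f c ∙ wdeg group f c                              ∎
      where
      open ≡-Reasoning
      open IsStar star
      leaf-entry : ∀ {v} → v ≢ c → ∀ u → Dec (u ≡ c) → entry v u ≡ δ c u (entry v u)
      leaf-entry {v} v≢c u (yes refl) = sym (δ-≡ u (entry v u))
      leaf-entry {v} v≢c u (no u≢c)   = trans (cong (λ b → if b then lab v u else ε) (leaves v≢c u≢c)) (sym (δ-≢ u≢c (entry v u)))
      weight : ∀ v → Dec (v ≡ c) → wdeg group f v ≡ δ c v (wdeg group f c) ∙ entry c v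
      weight v (yes refl) = sym (trans (cong₂ _∙_ (δ-≡ c (wdeg group f c)) (entry-diagonal c)) (identityʳ _))
      weight v (no v≢c)   = begin
        wdeg group f v                       ≡⟨ Σ-cong (λ u → leaf-entry v≢c u (u Fin.≟ c)) ⟩
        Σᶠ (λ u → δ c u (entry v u))         ≡⟨ Σ-δ c (entry v) ⟩
        entry v c                            ≡⟨ entry-sym v c ⟩
        entry c v                            ≡⟨ identityˡ _ ⟨
        ε ∙ entry c v                        ≡⟨ cong (_∙ entry c v) (δ-≢ v≢c (wdeg group f c)) ⟨
        δ c v (wdeg group f c) ∙ entry c v   ∎

  -- The handshake argument: every off-diagonal value occurs twice and cancels. Applied to the
  -- entries of a labelling, it shows that the weights sum to 0.
  symmetric-Σ : OrderTwo → ∀ {n} (h : Fin n → Fin n → C) → (∀ u v → h u v ≡ h v u) → (∀ v → h v v ≡ ε) →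
                Σᶠ (λ u → Σᶠ (h u)) ≡ ε
  symmetric-Σ o2 {zero}  h h-sym h-diag = refl
  symmetric-Σ o2 {suc n} h h-sym h-diag = begin
    h zero zero ∙ row ∙ Σᶠ (λ u → h (suc u) zero ∙ Σᶠ (λ v → h (suc u) (suc v)))
      ≡⟨ cong₂ _∙_ (trans (cong (_∙ row) (h-diag zero)) (identityˡ row)) (Σ-∙ (λ u → h (suc u) zero) (λ u → Σᶠ (λ v → h (suc u) (suc v)))) ⟩
    row ∙ (Σᶠ (λ u → h (suc u) zero) ∙ Σᶠ (λ u → Σᶠ (λ v → h (suc u) (suc v))))
      ≡⟨ cong₂ (λ x y → row ∙ (x ∙ y)) (Σ-cong (λ u → h-sym (suc u) zero)) (symmetric-Σ o2 (λ u v → h (suc u) (suc v)) (λ u v → h-sym (suc u) (suc v)) (h-diag ∘ suc)) ⟩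
    row ∙ (row ∙ ε)
      ≡⟨ cong (row ∙_) (identityʳ row) ⟩
    row ∙ row
      ≡⟨ o2 row ⟩
    ε ∎
    where
    open ≡-Reasoning
    open Fin.Fin using (zero; suc)
    row : C
    row = Σᶠ (λ v → h zero (suc v))

  record Complement {n : ℕ} (w : Fin n → C) (r : ℕ) : Set where
    field
      missing : List C
      perm    : universe ↭ tabulate w ++ missing
      size    : length missing ≡ r

  complement : ∀ {n r} (w : Fin n → C) → (∀ u v → w u ≡ w v → u ≡ v) → n + r ≡ k → Complement w r
  complement {n} {r} w inj eq with R , p ← ⊆⇒↭++ (tabulate w) (Uniqueₚ.tabulate⁺ (inj _ _)) (λ {z} _ → ∈-allFin z) =
    record { missing = R ; perm = p
           ; size = ℕₚ.+-cancelˡ-≡ n _ _ (trans (sym (trans (length-++ (tabulate w)) (cong (_+ length R) (length-tabulate w)))) (trans (sym (universe-length p)) (sym eq))) }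

  ∑-complement : ∀ {n r} {w : Fin n → C} (c : Complement w r) → ∑ universe ≡ ε → Σᶠ w ∙ ∑ (Complement.missing c) ≡ ε
  ∑-complement {w = w} c ∑≡ε = trans (cong (_∙ ∑ missing) (sym (∑-tabulate w))) (trans (sym (∑-++ (tabulate w) missing)) (trans (sym (∑-↭ perm)) ∑≡ε))
    where open Complement c

  order-three-excluded : ∀ {n} (G : Graph n) {c} → IsStar G c → OrderThree → suc n ≡ k → ¬ Admits G group
  order-three-excluded {n} G {c} star o3 eq (f , irregular) = go comp (∑-complement comp (∑-universe-order-three o3))
    where
    w : Fin n → C
    w = wdeg group f
    comp : Complement w 1
    comp = complement w irregular (trans (ℕₚ.+-comm n 1) eq)
    go : (c : Complement w 1) → Σᶠ w ∙ ∑ (Complement.missing c) ≡ ε → ⊥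
    go record { missing = x ∷ [] ; perm = perm } ∑≡ε =
      Unique-++-disjoint (tabulate w) (Unique-resp-↭ perm (Uniqueₚ.allFin⁺ k)) (∈-tabulate⁺ c) (here (sym x≡wc))
      where
      x≡wc : x ≡ w c
      x≡wc = ∙-cancelˡ (w c ∙ w c) x (w c) (begin
        w c ∙ w c ∙ x         ≡⟨ cong₂ _∙_ (star-∑ G f star) (identityʳ x) ⟨
        Σᶠ w ∙ (x ∙ ε)        ≡⟨ ∑≡ε ⟩
        ε                     ≡⟨ o3 (w c) ⟨
        w c ∙ (w c ∙ w c)     ≡⟨ assoc _ _ _ ⟨
        w c ∙ w c ∙ w c       ∎)
        where open ≡-Reasoning

  order-two-excluded : ∀ {n} (G : Graph n) → OrderTwo → 3 ≤ k → 2 + n ≡ k → ¬ Admits G group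
  order-two-excluded {n} G o2 3≤k eq (f , irregular) = go comp (∑-complement comp (∑-universe-order-two o2 3≤k))
    where
    w : Fin n → C
    w = wdeg group f
    comp : Complement w 2
    comp = complement w irregular (trans (ℕₚ.+-comm n 2) eq)
    go : (c : Complement w 2) → Σᶠ w ∙ ∑ (Complement.missing c) ≡ ε → ⊥
    go record { missing = x ∷ y ∷ [] ; perm = perm } ∑≡ε =
      Uniqueₚ.Unique[x∷xs]⇒x∉xs (Unique-++⁻ʳ (tabulate w) (Unique-resp-↭ perm (Uniqueₚ.allFin⁺ k))) (here (∙-cancelʳ y x y (trans xy (sym (o2 y)))))
      where
      open ≡-Reasoning
      xy : x ∙ y ≡ ε
      xy = begin
        x ∙ y                       ≡⟨ cong (x ∙_) (identityʳ y) ⟨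
        x ∙ (y ∙ ε)                 ≡⟨ identityˡ _ ⟨
        ε ∙ (x ∙ (y ∙ ε))           ≡⟨ cong (_∙ (x ∙ (y ∙ ε))) (symmetric-Σ o2 (entry G f) (entry-sym G f) (entry-diagonal G f)) ⟨
        Σᶠ w ∙ (x ∙ (y ∙ ε))        ≡⟨ ∑≡ε ⟩
        ε                           ∎

  -- Irregular labellings, up to the two exceptions

  -- When two disjoint edges exist the walks can be chosen with at least two vertices of each sign,
  -- which the group (ℤ₃)^q does admit.
  admits : ∀ {n} (G : Graph n) → 3 ≤ n → n < k → Connected G →
           Admits G group ⊎ (OrderThree × suc n ≡ k × ∃[ c ] IsStar G c) ⊎ (OrderTwo × 2 + n ≡ k)
  admits {zero}  G () _ _
  admits {suc m} G h lt connected = from-any (λ v → connected v Fin.zero) (outcome (λ v → connected v Fin.zero))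
    where
    n : ℕ
    n = suc m
    Result : Set
    Result = Admits G group ⊎ (OrderThree × suc n ≡ k × ∃[ c ] IsStar G c) ⊎ (OrderTwo × 2 + n ≡ k)
    outcome : ∀ {r} (walk : ∀ v → Reach G v r) → Outcome (count (sign ∘ walk)) (count (not ∘ sign ∘ walk))
    outcome walk = classify _ _ (subst (3 ≤_) (sym (count-not (sign ∘ walk))) h) (subst (_< k) (sym (count-not (sign ∘ walk))) lt)
    from-spread : Spread G → Result
    from-spread (spread walk 2≤p 2≤m) with outcome walk
    ... | success b                    = inj₁ (balanced⇒admits G walk b)
    ... | order-two o2 eq              = inj₂ (inj₂ (o2 , trans (cong (2 +_) (sym (count-not (sign ∘ walk)))) eq))
    ... | order-three _ _ _ (inj₁ p≡1) = contradiction (subst (2 ≤_) p≡1 2≤p) λ { (s≤s ()) }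
    ... | order-three _ _ _ (inj₂ m≡1) = contradiction (subst (2 ≤_) m≡1 2≤m) λ { (s≤s ()) }
    from-any : ∀ {r} (walk : ∀ v → Reach G v r) → Outcome (count (sign ∘ walk)) (count (not ∘ sign ∘ walk)) → Result
    from-any walk (success b)              = inj₁ (balanced⇒admits G walk b)
    from-any walk (order-two o2 eq)        = inj₂ (inj₂ (o2 , trans (cong (2 +_) (sym (count-not (sign ∘ walk)))) eq))
    from-any walk (order-three o3 eq h₄ _) =
      [ (λ star → inj₂ (inj₁ (o3 , trans (cong suc (sym (count-not (sign ∘ walk)))) eq , star))) , from-spread ∘ disjointEdges⇒spread connected ]′
        (star-or-disjointEdges G (subst (4 ≤_) (count-not (sign ∘ walk)) h₄) connected)

-- Transport between a group and its enumeration

module _ (A B : AbelianGroup 0ℓ 0ℓ) where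
  private
    module A = AbelianGroup A
    module B = AbelianGroup B

  admits-map : (φ : A.Carrier → B.Carrier) → (∀ {x y} → x A.≈ y → φ x B.≈ φ y) → (∀ {x y} → φ x B.≈ φ y → x A.≈ y) →
               (∀ x y → φ (x A.∙ y) B.≈ φ x B.∙ φ y) → ∀ {n} {G : Graph n} → Admits G A → Admits G B
  admits-map φ φ-cong φ-inj φ-∙ {n} {G} (f , irregular) =
    record { lab = λ u v → φ (lab u v) ; symm = λ u v → φ-cong (symm u v) } ,
    λ u v eq → irregular u v (φ-inj (B.trans (φ-wdeg u) (B.trans eq (B.sym (φ-wdeg v)))))
    where
    open Labelling f
    φ-ε : φ A.ε B.≈ B.ε
    φ-ε = AbelianGroupₚ.identityʳ-unique B (φ A.ε) (φ A.ε) (B.trans (B.sym (φ-∙ A.ε A.ε)) (φ-cong (A.identityˡ A.ε)))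
    φ-if : ∀ b x → φ (if b then x else A.ε) B.≈ (if b then φ x else B.ε)
    φ-if true  x = B.refl
    φ-if false x = φ-ε
    φ-Σ : ∀ {m} (g : Fin m → A.Carrier) (h : Fin m → B.Carrier) → (∀ i → φ (g i) B.≈ h i) → φ (ΣFin A g) B.≈ ΣFin B h
    φ-Σ {zero}  g h eq = φ-ε
    φ-Σ {suc m} g h eq = B.trans (φ-∙ _ _) (B.∙-cong (eq Fin.zero) (φ-Σ (g ∘ Fin.suc) (h ∘ Fin.suc) (eq ∘ Fin.suc)))
    φ-wdeg : ∀ u → φ (wdeg A f u) B.≈ ΣFin B (λ v → if Adj G u v then φ (lab u v) else B.ε)
    φ-wdeg u = φ-Σ _ _ (λ v → φ-if (Adj G u v) (lab u v))

module Transport (A : AbelianGroup 0ℓ 0ℓ) {k : ℕ} (order : HasOrder A k) where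
  open AbelianGroup A using (_≈_; rawGroup; isAbelianGroup; ∙-cong)
    renaming (_∙_ to _+ᴬ_; ε to 0ᴬ; _⁻¹ to -ᴬ_; refl to ≈-refl; sym to ≈-sym; trans to ≈-trans)
  open Inverse order using (to; from; to-cong; from-cong)
  open AbelianGroupₚ A using (identityʳ-unique)

  from-to : ∀ x → from (to x) ≈ x
  from-to x = Inverse.inverseʳ order refl

  to-from : ∀ i → to (from i) ≡ i
  to-from i = Inverse.inverseˡ order ≈-refl

  Γ : FinAbelianGroup k
  Γ = record
    { _∙_ = λ i j → to (from i +ᴬ from j)
    ; ε   = to 0ᴬ
    ; _⁻¹ = λ i → to (-ᴬ from i)
    ; isAbelianGroup = GroupMonomorphism.isAbelianGroup mono isAbelianGroup
    }
    where
    mono : IsGroupMonomorphism (record { _≈_ = _≡_ ; _∙_ = λ i j → to (from i +ᴬ from j) ; ε = to 0ᴬ ; _⁻¹ = λ i → to (-ᴬ from i) }) rawGroup from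
    mono = record
      { isGroupHomomorphism = record
        { isMonoidHomomorphism = record
          { isMagmaHomomorphism = record
            { isRelHomomorphism = record { cong = from-cong }
            ; homo = λ i j → from-to _ }
          ; ε-homo = from-to _ }
        ; ⁻¹-homo = λ i → from-to _ }
      ; injective = λ {i} {j} eq → trans (sym (to-from i)) (trans (to-cong eq) (to-from j))
      }

  open FiniteGroup Γ public using (group)
  open FinAbelianGroup Γ using (_∙_; ε)

  to-∙ : ∀ x y → to (x +ᴬ y) ≡ to x ∙ to y
  to-∙ x y = to-cong (∙-cong (≈-sym (from-to x)) (≈-sym (from-to y)))

  admits-from : ∀ {n} {G : Graph n} → Admits G group → Admits G A
  admits-from = admits-map group A from from-cong (λ {i} {j} eq → trans (sym (to-from i)) (trans (to-cong eq) (to-from j))) (λ i j → from-to _)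

  admits-to : ∀ {n} {G : Graph n} → Admits G A → Admits G group
  admits-to = admits-map A group to to-cong (λ {x} {y} eq → ≈-trans (≈-sym (from-to x)) (≈-trans (from-cong eq) (from-to y))) to-∙

  elementary : ∀ p .{{_ : NonZero p}} {q} → group ≅Zpow p ^ q → A ≅Zpow p ^ q
  elementary p (φ , φ-∙) =
    record { to = φ.to ∘ to ; from = from ∘ φ.from
           ; to-cong = φ.to-cong ∘ to-cong ; from-cong = from-cong ∘ φ.from-cong
           ; inverse = (λ {v} {x} eq → φ.inverseˡ (trans (to-cong eq) (to-from (φ.from v))))
                     , (λ {x} {v} eq → ≈-trans (from-cong (φ.inverseʳ eq)) (from-to x)) } ,
    λ x y → trans (cong φ.to (to-∙ x y)) (φ-∙ (to x) (to y))
    where module φ = Inverse φ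

  ≅Zpow-injective : ∀ p .{{_ : NonZero p}} {q} (iso : A ≅Zpow p ^ q) {x y} →
                    Inverse.to (proj₁ iso) x ≡ Inverse.to (proj₁ iso) y → x ≈ y
  ≅Zpow-injective p (φ , _) eq = ≈-trans (≈-sym (φ.inverseʳ refl)) (≈-trans (φ.from-cong eq) (φ.inverseʳ refl))
    where module φ = Inverse φ

  -- The isomorphism is only known to respect sums, so instead of 2x = 0 the equation 3x = x is
  -- checked on coordinates, which avoids the image of 0; cancelling x follows in the group. For
  -- exponent 3 the equation is 4x = x.
  order-two : ∀ {q} → A ≅Zpow 2 ^ q → FiniteGroup.OrderTwo Γ
  order-two iso@(φ , φ-∙) i = to-cong (identityʳ-unique x (x +ᴬ x)
    (≅Zpow-injective 2 iso (trans (φ-∙ x (x +ᴬ x)) (trans (cong (zipWith (addMod 2) u) (φ-∙ x x)) (thrice u)))))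
    where
    x = from i
    u = Inverse.to φ x
    thrice : ∀ {q} (v : Vec (Fin 2) q) → zipWith (addMod 2) v (zipWith (addMod 2) v v) ≡ v
    thrice []       = refl
    thrice (c ∷ v)  = cong₂ _∷_ (Finₚ.toℕ-injective (cases c)) (thrice v)
      where
      cases : ∀ c → toℕ (addMod 2 c (addMod 2 c c)) ≡ toℕ c
      cases Fin.zero           = refl
      cases (Fin.suc Fin.zero) = refl

  order-three : ∀ {q} → A ≅Zpow 3 ^ q → FiniteGroup.OrderThree Γ
  order-three iso@(φ , φ-∙) i = trans (to-cong (∙-cong ≈-refl (from-to (x +ᴬ x)))) (to-cong (identityʳ-unique x (x +ᴬ (x +ᴬ x))
    (≅Zpow-injective 3 iso (trans (φ-∙ x (x +ᴬ (x +ᴬ x)))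
      (trans (cong (zipWith (addMod 3) u) (trans (φ-∙ x (x +ᴬ x)) (cong (zipWith (addMod 3) u) (φ-∙ x x)))) (four-times u))))))
    where
    x = from i
    u = Inverse.to φ x
    four-times : ∀ {q} (v : Vec (Fin 3) q) → zipWith (addMod 3) v (zipWith (addMod 3) v (zipWith (addMod 3) v v)) ≡ v
    four-times []       = refl
    four-times (c ∷ v)  = cong₂ _∷_ (cases c) (four-times v)
      where
      cases : ∀ c → addMod 3 c (addMod 3 c (addMod 3 c c)) ≡ c
      cases Fin.zero                     = refl
      cases (Fin.suc Fin.zero)           = refl
      cases (Fin.suc (Fin.suc Fin.zero)) = refl

-- Cyclic groups and the lower bound for the strength

module Cyclic (s : ℕ) .{{_ : NonZero s}} where

  toℕ-addMod : ∀ i j → toℕ (addMod s i j) ≡ (toℕ i + toℕ j) % s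
  toℕ-addMod i j = Finₚ.toℕ-fromℕ< (m%n<n (toℕ i + toℕ j) s)

  %-+ˡ : ∀ m n → (m % s + n) % s ≡ (m + n) % s
  %-+ˡ m n = trans (%-distribˡ-+ (m % s) n s) (trans (cong (λ z → (z + n % s) % s) (m%n%n≡m%n m s)) (sym (%-distribˡ-+ m n s)))

  %-+ʳ : ∀ m n → (m + n % s) % s ≡ (m + n) % s
  %-+ʳ m n = trans (cong (_% s) (ℕₚ.+-comm m (n % s))) (trans (%-+ˡ n m) (cong (_% s) (ℕₚ.+-comm n m)))

  toℕ-% : ∀ (i : Fin s) → toℕ i % s ≡ toℕ i
  toℕ-% i = m<n⇒m%n≡m (Finₚ.toℕ<n i)

  comm : ∀ i j → addMod s i j ≡ addMod s j i
  comm i j = cong (_mod s) (ℕₚ.+-comm (toℕ i) (toℕ j))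

  assoc : ∀ i j l → addMod s (addMod s i j) l ≡ addMod s i (addMod s j l)
  assoc i j l = Finₚ.toℕ-injective (begin
    toℕ (addMod s (addMod s i j) l)          ≡⟨ toℕ-addMod (addMod s i j) l ⟩
    (toℕ (addMod s i j) + toℕ l) % s         ≡⟨ cong (λ z → (z + toℕ l) % s) (toℕ-addMod i j) ⟩
    ((toℕ i + toℕ j) % s + toℕ l) % s        ≡⟨ %-+ˡ (toℕ i + toℕ j) (toℕ l) ⟩
    (toℕ i + toℕ j + toℕ l) % s              ≡⟨ cong (_% s) (ℕₚ.+-assoc (toℕ i) (toℕ j) (toℕ l)) ⟩
    (toℕ i + (toℕ j + toℕ l)) % s            ≡⟨ %-+ʳ (toℕ i) (toℕ j + toℕ l) ⟨
    (toℕ i + (toℕ j + toℕ l) % s) % s        ≡⟨ cong (λ z → (toℕ i + z) % s) (toℕ-addMod j l) ⟨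
    (toℕ i + toℕ (addMod s j l)) % s         ≡⟨ toℕ-addMod i (addMod s j l) ⟨
    toℕ (addMod s i (addMod s j l))          ∎)
    where open ≡-Reasoning

  0ˢ : Fin s
  0ˢ = 0 mod s

  -ˢ_ : Fin s → Fin s
  -ˢ i = (s ∸ toℕ i) mod s

  identityˡ : ∀ i → addMod s 0ˢ i ≡ i
  identityˡ i = Finₚ.toℕ-injective (trans (toℕ-addMod 0ˢ i) (trans (cong (λ z → (z + toℕ i) % s) (Finₚ.toℕ-fromℕ< (m%n<n 0 s)))
    (trans (%-+ˡ 0 (toℕ i)) (toℕ-% i))))

  inverseˡ : ∀ i → addMod s (-ˢ i) i ≡ 0ˢ
  inverseˡ i = Finₚ.toℕ-injective (begin
    toℕ (addMod s (-ˢ i) i)               ≡⟨ toℕ-addMod (-ˢ i) i ⟩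
    (toℕ (-ˢ i) + toℕ i) % s              ≡⟨ cong (λ z → (z + toℕ i) % s) (Finₚ.toℕ-fromℕ< (m%n<n (s ∸ toℕ i) s)) ⟩
    ((s ∸ toℕ i) % s + toℕ i) % s         ≡⟨ %-+ˡ (s ∸ toℕ i) (toℕ i) ⟩
    (s ∸ toℕ i + toℕ i) % s               ≡⟨ cong (_% s) (ℕₚ.m∸n+n≡m (ℕₚ.<⇒≤ (Finₚ.toℕ<n i))) ⟩
    s % s                                 ≡⟨ [m+n]%n≡m%n 0 s ⟩
    0 % s                                 ≡⟨ Finₚ.toℕ-fromℕ< (m%n<n 0 s) ⟨
    toℕ 0ˢ                                ∎)
    where open ≡-Reasoning

  cyclicGroup : AbelianGroup 0ℓ 0ℓ
  cyclicGroup = record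
    { _≈_ = _≡_ ; _∙_ = addMod s ; ε = 0ˢ ; _⁻¹ = -ˢ_
    ; isAbelianGroup = record
      { isGroup = record
        { isMonoid = record
          { isSemigroup = record
            { isMagma = record { isEquivalence = ≡.isEquivalence ; ∙-cong = cong₂ (addMod s) }
            ; assoc = assoc }
          ; identity = identityˡ , λ i → trans (comm i 0ˢ) (identityˡ i) }
        ; inverse = inverseˡ , λ i → trans (comm i (-ˢ i)) (inverseˡ i)
        ; ⁻¹-cong = cong -ˢ_ }
      ; comm = comm }
    }

  cyclicGroup-order : HasOrder cyclicGroup s
  cyclicGroup-order = record { to = λ i → i ; from = λ i → i ; to-cong = λ p → p ; from-cong = λ p → p ; inverse = (λ p → p) , (λ p → p) }

-- `GoodOrder` quantifies over all groups of order `s` and bounds `s` only once such a group is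
-- exhibited. The cyclic one serves: its `s` elements must accommodate `n` different weights.
goodOrder⇒≤ : ∀ {n} {G : Graph n} {s} → 1 ≤ s → GoodOrder G s → n ≤ s
goodOrder⇒≤ {s = suc s} _ good with f , irregular ← good (Cyclic.cyclicGroup (suc s)) (Cyclic.cyclicGroup-order (suc s)) =
  Finₚ.injective⇒≤ {f = wdeg (Cyclic.cyclicGroup (suc s)) f} (irregular _ _)

theorem1p2 : (n : ℕ) (G : Graph n) → 3 ≤ n → Connected G →
    (s : ℕ) → IsGroupIrregStrength G s →
    (k : ℕ) → s < k →
    (A : AbelianGroup 0ℓ 0ℓ) → HasOrder A k →
    ((¬ ExceptionI G A → ¬ ExceptionII n A → Admits G A)
     × (ExceptionI G A ⊎ ExceptionII n A → ¬ Admits G A))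
theorem1p2 (suc n) G 3≤n connected s (1≤s , good , _) k s<k A order = positive , negative
  where
  open Transport A order
  positive : ¬ ExceptionI G A → ¬ ExceptionII (suc n) A → Admits G A
  positive ¬I ¬II with FiniteGroup.admits Γ G 3≤n (ℕₚ.≤-<-trans (goodOrder⇒≤ 1≤s good) s<k) connected
  ... | inj₁ adm                        = admits-from adm
  ... | inj₂ (inj₁ (o3 , eq , _ , star)) with q , 3^q≡k , iso ← FiniteGroup.order-three⇒elementary Γ o3 =
    contradiction (star⇒≅K1 star , q , trans 3^q≡k (sym eq) , elementary 3 iso) ¬I
  ... | inj₂ (inj₂ (o2 , eq))           with q , 2^q≡k , iso ← FiniteGroup.order-two⇒elementary Γ o2 =
    contradiction (q , trans 2^q≡k (sym eq) , elementary 2 iso) ¬II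
  -- Combined with the equation for `p ^ q` in an exception, this fixes how many group elements are
  -- missing among the weights: one in the first, two in the second.
  size : ∀ p .{{_ : NonZero p}} {q} → A ≅Zpow p ^ q → p ℕ.^ q ≡ k
  size p {q} (φ , _) = Permutation.↔⇒≡ (mk↔ₛ′ (to ∘ φ.from ∘ decode p) (encode p ∘ φ.to ∘ from)
    (λ i → trans (to-cong (φ.inverseʳ (decode-encode p _))) (to-from i))
    (λ i → trans (cong (encode p) (φ.inverseˡ (from-to _))) (encode-decode p q i)))
    where
    module φ = Inverse φ
    open Inverse order using (to; from; to-cong)
  negative : ExceptionI G A ⊎ ExceptionII (suc n) A → ¬ Admits G A
  negative (inj₁ (≅K1 , q , 3^q , iso)) adm = FiniteGroup.order-three-excluded Γ G (proj₂ (≅K1⇒star ≅K1)) (order-three iso)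
    (trans (sym 3^q) (size 3 iso)) (admits-to adm)
  negative (inj₂ (q , 2^q , iso)) adm = FiniteGroup.order-two-excluded Γ G (order-two iso)
    (ℕₚ.≤-trans 3≤n (ℕₚ.≤-trans (goodOrder⇒≤ 1≤s good) (ℕₚ.<⇒≤ s<k))) (trans (sym 2^q) (size 2 iso)) (admits-to adm)
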